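{- Let $c$, $k$ and $t$ be positive integers with $c\ge 3$ and $k\ge t+2$. Suppose $\mathcal{F}$ and $\mathcal{G}$ are non-empty cross $t$-intersecting subfamilies of $U^{[ck]}_{c,k}$ such that $|\mathcal{F}|\le|\mathcal{G}|$ and $|\mathcal{F}|+|\mathcal{G}|$ is maximum among all such pairs. If $c\ge 3+2\log_2 t$ or $k\ge 2t+2$, then $\mathcal{F}=\{C\}$ and $\mathcal{G}=\{F\in U^{[ck]}_{c,k}: |F\cap C|\ge t\}$ for some $C\in U^{[ck]}_{c,k}$.
   Context: For positive integers $c,k,\ell$, $U^{[ck]}_{c,\ell}$ denotes the set of all families of $\ell$ pairwise disjoint $c$-subsets ("blocks") of $[ck]$; $U^{[ck]}_{c,k}$ is the set of $c$-uniform partitions of $[ck]$. For such families $A,B$, $A\cap B$ denotes the set of common blocks. Families $\mathcal{A},\mathcal{B}$ are cross $t$-intersecting if $|A\cap B|\ge t$ for all $A\in\mathcal{A}$, $B\in\mathcal{B}$. -}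

module Defs where

open import Data.Nat using (ℕ; _*_; _≤_; _+_)
open import Data.Fin using (Fin)
open import Data.Fin.Subset using (Subset; _∈_; ∣_∣)
open import Data.Vec using (Vec; lookup)
open import Data.List using (List; length)
open import Data.List.Membership.Propositional renaming (_∈_ to _∈ₗ_)
open import Data.List.Relation.Unary.All using (All)
open import Data.List.Relation.Unary.Unique.Propositional using (Unique)
open import Data.Product using (Σ; ∃; _×_)
open import Function.Definitions using (Injective)
open import Relation.Binary.PropositionalEquality using (_≡_)

-- Encoding of a family of pairwise disjoint blocks covering [n] (n = c*k):
-- a vector β assigning to every point i ∈ [n] the block β[i] containing it.
-- This encoding is canonical (each c-uniform partition of [ck] has exactly
-- one such vector), so ≡ on codes is equality of partitions.
Code : ℕ → Set
Code n = Vec (Subset n) n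

IsUniformPartition : (c n : ℕ) → Code n → Set
IsUniformPartition c n β =
  ((i : Fin n) → i ∈ lookup β i) ×
  ((i : Fin n) → ∣ lookup β i ∣ ≡ c) ×
  ((i j : Fin n) → j ∈ lookup β i → lookup β j ≡ lookup β i)

U : (c k : ℕ) → Set
U c k = Σ (Code (c * k)) (IsUniformPartition c (c * k))

IsBlock : {n : ℕ} → Code n → Subset n → Set
IsBlock {n} β S = ∃ λ (i : Fin n) → lookup β i ≡ S

CommonAtLeast : {n : ℕ} → ℕ → Code n → Code n → Set
CommonAtLeast {n} t A B =
  Σ (Fin t → Subset n) λ f → Injective _≡_ _≡_ f ×
    ((j : Fin t) → IsBlock A (f j) × IsBlock B (f j))

-- A (finite) subfamily of U^{[ck]}_{c,k}: a duplicate-free list of codes of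
-- c-uniform partitions; its cardinality is the length of the list.
IsSubfamily : (c k : ℕ) → List (Code (c * k)) → Set
IsSubfamily c k 𝓕 = Unique 𝓕 × All (IsUniformPartition c (c * k)) 𝓕

CrossIntersecting : {n : ℕ} → ℕ → List (Code n) → List (Code n) → Set
CrossIntersecting t 𝓕 𝓖 = ∀ {A B} → A ∈ₗ 𝓕 → B ∈ₗ 𝓖 → CommonAtLeast t A B

NonEmpty : {A : Set} → List A → Set
NonEmpty xs = 1 ≤ length xs

Admissible : (c k t : ℕ) → List (Code (c * k)) → List (Code (c * k)) → Set
Admissible c k t 𝓕 𝓖 =
  IsSubfamily c k 𝓕 × IsSubfamily c k 𝓖 × NonEmpty 𝓕 × NonEmpty 𝓖 ×
  CrossIntersecting t 𝓕 𝓖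

{-# OPTIONS --safe #-}
module Submission where

open import Defs
open import Algebra.Properties.CommutativeSemigroup using (interchange)
open import Data.Bool as Bool using (true; false)
open import Data.Empty using (⊥-elim)
open import Data.Fin as Fin using (Fin; zero; suc)
open import Data.Fin.Permutation using (Permutation′; _⟨$⟩ˡ_; _⟨$⟩ʳ_; inverseˡ; inverseʳ; transpose)
open import Data.Fin.Properties using (all?; any?; suc-injective)
import Data.Fin.Subset as Sub
open import Data.Fin.Subset using (Subset; ∣_∣)
open import Data.Fin.Subset.Properties using (_∈?_; _⊆?_; x∈p∪q⁻; p⊆p∪q; q⊆p∪q; ⊆-antisym; p⊂q⇒∣p∣<∣q∣; p⊆q⇒∣p∣≤∣q∣; ∣⊥∣≡0; ∉⊥; ∣∁p∣≡n∸∣p∣; x∈∁p⇒x∉p; x∉p⇒x∈∁p; p∩q⊆p; p∩q⊆q; x∈p∩q⁺; ∣⁅x⁆∣≡1; x∈⁅x⁆)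
open import Data.List using (List; []; _∷_; _++_; length; filter; map; allFin; cartesianProduct; cartesianProductWith)
import Data.List.Membership.DecPropositional as DecMembership
open import Data.List.Membership.Propositional using (_∈_; find)
open import Data.List.Membership.Propositional.Properties using (∈-∃++; ∈-++⁺ˡ; ∈-++⁺ʳ; ∈-++⁻; ∈-filter⁺; ∈-filter⁻; ∈-allFin; ∈-map⁻; ∈-cartesianProductWith⁺; ∈-cartesianProduct⁻)
open import Data.List.Properties using (length-++; length-map; map-tabulate)
open import Data.List.Relation.Binary.Subset.Propositional using (_⊆_)
open import Data.List.Relation.Unary.All as All using (All; []; _∷_)
open import Data.List.Relation.Unary.All.Properties using (¬All⇒Any¬)
open import Data.List.Relation.Unary.AllPairs using ([]; _∷_)
open import Data.List.Relation.Unary.Any using (here; there)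
open import Data.List.Relation.Unary.Unique.Propositional using (Unique)
open import Data.List.Relation.Unary.Unique.Propositional.Properties using (allFin⁺; cartesianProductWith⁺; cartesianProduct⁺) renaming (filter⁺ to Unique-filter⁺; map⁺ to Unique-map⁺)
open import Data.Nat using (ℕ; zero; suc; _*_; _≤_; _<_; _+_; _∸_; _^_; z≤n; s≤s; s≤s⁻¹; _≟_; _≤?_; NonZero; >-nonZero)
open import Data.Nat.Properties hiding (_≟_; _≤?_; suc-injective)
open import Data.Nat.Tactic.RingSolver using (solve-∀)
open import Data.Product using (Σ; ∃; _×_; _,_; proj₁; proj₂)
open import Data.Sum using (_⊎_; inj₁; inj₂)
open import Data.Vec as Vec using (Vec; []; _∷_; lookup)
open import Data.Vec.Properties using (≡-dec; lookup∘tabulate; tabulate∘lookup; lookup⇒[]=; []=⇒lookup) renaming (tabulate-cong to Vec-tabulate-cong)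
open import Function using (_∘_; id)
open import Function.Bundles using (_⇔_; mk⇔)
open import Function.Definitions using (Injective)
open import Relation.Binary.PropositionalEquality using (_≡_; _≢_; refl; sym; trans; cong; cong₂; subst; module ≡-Reasoning)
open import Relation.Nullary using (¬_; Dec; yes; no; does; contradiction; ¬?)
open import Relation.Nullary.Decidable using (_×-dec_; _→-dec_; dec-true; map′; decidable-stable)
open import Relation.Unary using (Decidable)

-- Write n = ck and m = k − t ≥ 2. Two partitions have t common blocks iff their codes agree in at
-- least ct points. Fix A ∈ 𝓕; the competitor ({A}, all B agreeing with A in ≥ ct points) has size 1 + M.
--
-- Let W be a union of t blocks of A and p(W) the number of partitions that agree with A on W.
-- If x is a c-set disjoint from W, then swapping a point i ∈ x with a point j outside x ∪ W maps
-- partitions with block x injectively to partitions with block x − i + j. As c ≥ 3, these c²(m − 1)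
-- sets pairwise meet, so no partition has two of them as blocks, and a fraction of at most
-- 1/(c²(m − 1)) ≤ 1/(4m) of the p(W) partitions has x as a block. Averaging over the m blocks of a
-- partition D outside W, at most p(W)/4 of them agree with D somewhere outside W. Therefore
--   * at least 3p(W)/4 of them agree with A exactly on W (take D = A);
--   * at most p(W)/4 of them lie in 𝓖, if some D ∈ 𝓕 differs from A somewhere on W.
--
-- Suppose 𝓕 has a second member A′. Let S be the set of points where all of 𝓕 agrees.
-- If ∣S∣ < ct, the second bullet applies to every W, and summing over W gives 2∣𝓖∣ ≤ M.
-- If ∣S∣ ≥ ct, let R ⊆ S be a union of t − 1 blocks. Then ∣𝓕∣ ≤ p(R ∪ z) for a further block z ⊆ S,
-- and A has two blocks x, y on which A′ differs from it. All these p-values are equal, and at least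
-- half of the partitions counted by each of p(R ∪ x), p(R ∪ y) agree with A exactly there and are
-- missed by 𝓖. So ∣𝓕∣ + ∣𝓖∣ ≤ M in both cases, against maximality.

-- Finite sums and counting

private
  variable
    X Y : Set
    P Q R : Set

∑ : List X → (X → ℕ) → ℕ
∑ []       f = 0
∑ (x ∷ xs) f = f x + ∑ xs f

𝟙 : Dec P → ℕ
𝟙 (yes _) = 1
𝟙 (no _)  = 0

𝟙-mono : (P? : Dec P) (Q? : Dec Q) → (P → Q) → 𝟙 P? ≤ 𝟙 Q?
𝟙-mono (no _)  _       _ = z≤n
𝟙-mono (yes _) (yes _) _ = ≤-refl
𝟙-mono (yes p) (no ¬q) f = contradiction (f p) ¬q

𝟙-true : (P? : Dec P) → P → 𝟙 P? ≡ 1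
𝟙-true (yes _) _ = refl
𝟙-true (no ¬p) p = contradiction p ¬p

𝟙-≤ : (P? : Dec P) {a : ℕ} → (P → 1 ≤ a) → 𝟙 P? ≤ a
𝟙-≤ (yes p) 1≤a = 1≤a p
𝟙-≤ (no _)  _   = z≤n

𝟙-⊎ : (P? : Dec P) (Q? : Dec Q) (R? : Dec R) → (P → Q ⊎ R) → 𝟙 P? ≤ 𝟙 Q? + 𝟙 R?
𝟙-⊎ (no _)  _       _       _ = z≤n
𝟙-⊎ (yes _) (yes _) _       _ = s≤s z≤n
𝟙-⊎ (yes _) (no _)  (yes _) _ = ≤-refl
𝟙-⊎ (yes p) (no ¬q) (no ¬r) f with f p
... | inj₁ q = contradiction q ¬q
... | inj₂ r = contradiction r ¬r

𝟙-disjoint : (P? : Dec P) (Q? : Dec Q) (R? : Dec R) →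
  (P → R) → (Q → R) → (P → ¬ Q) → 𝟙 P? + 𝟙 Q? ≤ 𝟙 R?
𝟙-disjoint (no _)  Q?      R? _   Q⇒R _    = 𝟙-mono Q? R? Q⇒R
𝟙-disjoint (yes p) (no _)  R? P⇒R _   _    = 𝟙-mono (yes p) R? P⇒R
𝟙-disjoint (yes p) (yes q) _  _   _   P⇒¬Q = contradiction q (P⇒¬Q p)

∑-mono : ∀ (xs : List X) {f g : X → ℕ} → (∀ {x} → x ∈ xs → f x ≤ g x) → ∑ xs f ≤ ∑ xs g
∑-mono []       f≤g = z≤n
∑-mono (x ∷ xs) f≤g = +-mono-≤ (f≤g (here refl)) (∑-mono xs (f≤g ∘ there))

∑-cong : ∀ (xs : List X) {f g : X → ℕ} → (∀ x → f x ≡ g x) → ∑ xs f ≡ ∑ xs g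
∑-cong []       f≡g = refl
∑-cong (x ∷ xs) f≡g = cong₂ _+_ (f≡g x) (∑-cong xs f≡g)

∑-+ : ∀ (xs : List X) (f g : X → ℕ) → ∑ xs (λ x → f x + g x) ≡ ∑ xs f + ∑ xs g
∑-+ []       f g = refl
∑-+ (x ∷ xs) f g = trans (cong (f x + g x +_) (∑-+ xs f g)) (interchange +-commutativeSemigroup (f x) (g x) _ _)

∑-* : ∀ (xs : List X) a (f : X → ℕ) → ∑ xs (λ x → a * f x) ≡ a * ∑ xs f
∑-* []       a f = sym (*-zeroʳ a)
∑-* (x ∷ xs) a f = trans (cong (a * f x +_) (∑-* xs a f)) (sym (*-distribˡ-+ a (f x) _))

∑-const : ∀ (xs : List X) a → ∑ xs (λ _ → a) ≡ length xs * a
∑-const []       a = refl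
∑-const (x ∷ xs) a = cong (a +_) (∑-const xs a)

∑-zero : ∀ (xs : List X) → ∑ xs (λ _ → 0) ≡ 0
∑-zero xs = trans (∑-const xs 0) (*-zeroʳ (length xs))

∑-swap : ∀ (xs : List X) (ys : List Y) (f : X → Y → ℕ) →
  ∑ xs (λ x → ∑ ys (f x)) ≡ ∑ ys (λ y → ∑ xs (λ x → f x y))
∑-swap []       ys f = sym (∑-zero ys)
∑-swap (x ∷ xs) ys f = trans (cong (∑ ys (f x) +_) (∑-swap xs ys f)) (sym (∑-+ ys (f x) _))

∑-∈ : ∀ {xs : List X} {x} (f : X → ℕ) → x ∈ xs → f x ≤ ∑ xs f
∑-∈ f (here refl)  = m≤m+n _ _
∑-∈ f (there x∈xs) = ≤-trans (∑-∈ f x∈xs) (m≤n+m _ _)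

length-filter : ∀ {P : X → Set} (P? : Decidable P) (xs : List X) →
  length (filter P? xs) ≡ ∑ xs (λ x → 𝟙 (P? x))
length-filter P? []       = refl
length-filter P? (x ∷ xs) with P? x
... | yes _ = cong suc (length-filter P? xs)
... | no _  = length-filter P? xs

length-cartesianProduct : ∀ (xs : List X) (ys : List Y) →
  length (cartesianProduct xs ys) ≡ length xs * length ys
length-cartesianProduct []       ys = refl
length-cartesianProduct (x ∷ xs) ys =
  trans (length-++ (map (x ,_) ys)) (cong₂ _+_ (length-map (x ,_) ys) (length-cartesianProduct xs ys))

-- After the first `x` with `P x`, exclusivity and the absence of repetitions make every later term
-- vanish. This bounds the inner sum of a double count in which each partition may be charged only
-- once.
∑-exclusive : ∀ {P : X → Set} (P? : Decidable P) (Q? : Dec Q) {xs : List X} → Unique xs →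
  (∀ {x y} → x ∈ xs → y ∈ xs → P x → P y → x ≡ y) → (∀ {x} → x ∈ xs → P x → Q) →
  ∑ xs (λ x → 𝟙 (P? x)) ≤ 𝟙 Q?
∑-exclusive P? Q? {[]}     _            _    _   = z≤n
∑-exclusive {P = P} P? Q? {x ∷ xs} (x∉xs ∷ xs!) P⇒≡ P⇒Q with P? x
... | no _   = ∑-exclusive P? Q? xs! (λ y∈ z∈ → P⇒≡ (there y∈) (there z∈)) (P⇒Q ∘ there)
... | yes px = begin
  1 + ∑ xs (λ y → 𝟙 (P? y)) ≤⟨ +-monoʳ-≤ 1 (∑-mono xs none) ⟩
  1 + ∑ xs (λ _ → 0)        ≡⟨ cong suc (∑-zero xs) ⟩
  1                         ≡⟨ 𝟙-true Q? (P⇒Q (here refl) px) ⟨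
  𝟙 Q?                      ∎
  where
  open ≤-Reasoning
  none : ∀ {y} → y ∈ xs → 𝟙 (P? y) ≤ 0
  none {y} y∈xs with P? y
  ... | no _   = z≤n
  ... | yes py = contradiction (P⇒≡ (here refl) (there y∈xs) px py) (All.lookup x∉xs y∈xs)

-- Induction on `xs`: deleting one occurrence of the head from `ys` leaves a list that still
-- contains the tail.
Unique-⊆⇒length≤ : ∀ {xs ys : List X} → Unique xs → xs ⊆ ys → length xs ≤ length ys
Unique-⊆⇒length≤ {xs = []}     _            _     = z≤n
Unique-⊆⇒length≤ {xs = x ∷ xs} {ys} (x∉xs ∷ xs!) xs⊆ys with ∈-∃++ (xs⊆ys (here refl))
... | as , bs , refl = begin
  suc (length xs)              ≤⟨ s≤s (Unique-⊆⇒length≤ xs! sub) ⟩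
  suc (length (as ++ bs))    ≡⟨ cong suc (length-++ as) ⟩
  suc (length as + length bs)  ≡⟨ +-suc (length as) (length bs) ⟨
  length as + suc (length bs)  ≡⟨ length-++ as ⟨
  length (as ++ x ∷ bs)      ∎
  where
  open ≤-Reasoning
  sub : xs ⊆ as ++ bs
  sub {y} y∈xs with ∈-++⁻ as (xs⊆ys (there y∈xs))
  ... | inj₁ y∈as         = ∈-++⁺ˡ y∈as
  ... | inj₂ (here refl)  = contradiction refl (All.lookup x∉xs y∈xs)
  ... | inj₂ (there y∈bs) = ∈-++⁺ʳ as y∈bs

count-injection : ∀ {P : X → Set} {Q : Y → Set} (P? : Decidable P) (Q? : Decidable Q)
  {xs : List X} {ys : List Y} → Unique xs →
  (f : X → Y) → (∀ {x y} → f x ≡ f y → x ≡ y) →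
  (∀ {x} → x ∈ xs → P x → f x ∈ ys × Q (f x)) →
  ∑ xs (λ x → 𝟙 (P? x)) ≤ ∑ ys (λ y → 𝟙 (Q? y))
count-injection P? Q? {xs} {ys} xs! f f-inj P⇒Q = begin
  ∑ xs (λ x → 𝟙 (P? x))           ≡⟨ length-filter P? xs ⟨
  length (filter P? xs)           ≡⟨ length-map f (filter P? xs) ⟨
  length (map f (filter P? xs))   ≤⟨ Unique-⊆⇒length≤ (Unique-map⁺ f-inj (Unique-filter⁺ P? xs!)) sub ⟩
  length (filter Q? ys)           ≡⟨ length-filter Q? ys ⟩
  ∑ ys (λ y → 𝟙 (Q? y))           ∎
  where
  open ≤-Reasoning
  sub : map f (filter P? xs) ⊆ filter Q? ys
  sub y∈ with ∈-map⁻ f y∈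
  ... | x , x∈ , refl with ∈-filter⁻ P? x∈
  ...   | x∈xs , px with P⇒Q x∈xs px
  ...     | fx∈ys , qfx = ∈-filter⁺ Q? fx∈ys qfx

∑-map : ∀ (g : Y → X) (ys : List Y) (f : X → ℕ) → ∑ (map g ys) f ≡ ∑ ys (f ∘ g)
∑-map g []       f = refl
∑-map g (y ∷ ys) f = cong (f (g y) +_) (∑-map g ys f)

∣∣≡∑ : ∀ {n} (p : Subset n) → ∣ p ∣ ≡ ∑ (allFin n) (λ v → 𝟙 (v ∈? p))
∣∣≡∑ []          = refl
∣∣≡∑ {suc n} (s ∷ p) = begin
  ∣ s ∷ p ∣                                                                ≡⟨ head s ⟩
  𝟙 (zero ∈? (s ∷ p)) + ∣ p ∣                                              ≡⟨ cong (𝟙 (zero ∈? (s ∷ p)) +_) (∣∣≡∑ p) ⟩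
  𝟙 (zero ∈? (s ∷ p)) + ∑ (allFin n) (λ v → 𝟙 (v ∈? p))                    ≡⟨ cong (𝟙 (zero ∈? (s ∷ p)) +_) (∑-cong (allFin n) tail) ⟩
  𝟙 (zero ∈? (s ∷ p)) + ∑ (allFin n) (λ v → 𝟙 (suc v ∈? (s ∷ p)))          ≡⟨ cong (𝟙 (zero ∈? (s ∷ p)) +_) (∑-map suc (allFin n) _) ⟨
  𝟙 (zero ∈? (s ∷ p)) + ∑ (map suc (allFin n)) (λ v → 𝟙 (v ∈? (s ∷ p)))    ≡⟨ cong (λ l → 𝟙 (zero ∈? (s ∷ p)) + ∑ l (λ v → 𝟙 (v ∈? (s ∷ p)))) (map-tabulate (id {A = Fin n}) suc) ⟩
  ∑ (allFin (suc n)) (λ v → 𝟙 (v ∈? (s ∷ p)))                              ∎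
  where
  open ≡-Reasoning
  head : ∀ s → ∣ s ∷ p ∣ ≡ 𝟙 (zero ∈? (s ∷ p)) + ∣ p ∣
  head true  = refl
  head false = refl
  tail : ∀ v → 𝟙 (v ∈? p) ≡ 𝟙 (suc v ∈? (s ∷ p))
  tail v with v ∈? p
  ... | yes _ = refl
  ... | no _  = refl

∣∣-injection : ∀ {n} (p q : Subset n) (f : Fin n → Fin n) → (∀ {u v} → f u ≡ f v → u ≡ v) →
  (∀ {v} → v Sub.∈ p → f v Sub.∈ q) → ∣ p ∣ ≤ ∣ q ∣
∣∣-injection {n} p q f f-inj p⇒q = begin
  ∣ p ∣                                 ≡⟨ ∣∣≡∑ p ⟩
  ∑ (allFin n) (λ v → 𝟙 (v ∈? p))       ≤⟨ count-injection (_∈? p) (_∈? q) (allFin⁺ n) f f-inj (λ {v} _ v∈p → ∈-allFin (f v) , p⇒q v∈p) ⟩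
  ∑ (allFin n) (λ v → 𝟙 (v ∈? q))       ≡⟨ ∣∣≡∑ q ⟨
  ∣ q ∣                                 ∎
  where open ≤-Reasoning

Disjoint : ∀ {n} → Subset n → Subset n → Set
Disjoint p q = ∀ {v} → v Sub.∈ p → v Sub.∉ q

∣∪∣≤ : ∀ {n} (p q : Subset n) → ∣ p Sub.∪ q ∣ ≤ ∣ p ∣ + ∣ q ∣
∣∪∣≤ {n} p q = begin
  ∣ p Sub.∪ q ∣                                                       ≡⟨ ∣∣≡∑ (p Sub.∪ q) ⟩
  ∑ (allFin n) (λ v → 𝟙 (v ∈? (p Sub.∪ q)))                           ≤⟨ ∑-mono (allFin n) (λ {v} _ → 𝟙-⊎ (v ∈? (p Sub.∪ q)) (v ∈? p) (v ∈? q) (x∈p∪q⁻ p q)) ⟩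
  ∑ (allFin n) (λ v → 𝟙 (v ∈? p) + 𝟙 (v ∈? q))                        ≡⟨ ∑-+ (allFin n) _ _ ⟩
  ∑ (allFin n) (λ v → 𝟙 (v ∈? p)) + ∑ (allFin n) (λ v → 𝟙 (v ∈? q))   ≡⟨ cong₂ _+_ (∣∣≡∑ p) (∣∣≡∑ q) ⟨
  ∣ p ∣ + ∣ q ∣                                                       ∎
  where open ≤-Reasoning

∣∪∣-disjoint : ∀ {n} (p q : Subset n) → Disjoint p q → ∣ p Sub.∪ q ∣ ≡ ∣ p ∣ + ∣ q ∣
∣∪∣-disjoint {n} p q p#q = begin
  ∣ p Sub.∪ q ∣                                                       ≡⟨ ∣∣≡∑ (p Sub.∪ q) ⟩
  ∑ (allFin n) (λ v → 𝟙 (v ∈? (p Sub.∪ q)))                           ≡⟨ ∑-cong (allFin n) pointwise ⟩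
  ∑ (allFin n) (λ v → 𝟙 (v ∈? p) + 𝟙 (v ∈? q))                        ≡⟨ ∑-+ (allFin n) _ _ ⟩
  ∑ (allFin n) (λ v → 𝟙 (v ∈? p)) + ∑ (allFin n) (λ v → 𝟙 (v ∈? q))   ≡⟨ cong₂ _+_ (∣∣≡∑ p) (∣∣≡∑ q) ⟨
  ∣ p ∣ + ∣ q ∣                                                       ∎
  where
  open ≡-Reasoning
  pointwise : ∀ v → 𝟙 (v ∈? (p Sub.∪ q)) ≡ 𝟙 (v ∈? p) + 𝟙 (v ∈? q)
  pointwise v = ≤-antisym
    (𝟙-⊎ (v ∈? (p Sub.∪ q)) (v ∈? p) (v ∈? q) (x∈p∪q⁻ p q))
    (𝟙-disjoint (v ∈? p) (v ∈? q) (v ∈? (p Sub.∪ q)) (p⊆p∪q q) (q⊆p∪q p q) p#q)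

⊆∧∣∣≤⇒≡ : ∀ {n} {p q : Subset n} → p Sub.⊆ q → ∣ q ∣ ≤ ∣ p ∣ → p ≡ q
⊆∧∣∣≤⇒≡ {p = p} {q} p⊆q ∣q∣≤∣p∣ = ⊆-antisym p⊆q back
  where
  back : q Sub.⊆ p
  back {v} v∈q with v ∈? p
  ... | yes v∈p = v∈p
  ... | no  v∉p = contradiction (p⊂q⇒∣p∣<∣q∣ (p⊆q , v , v∈q , v∉p)) (≤⇒≯ ∣q∣≤∣p∣)

∃∈∖ : ∀ {n} (p q : Subset n) → p Sub.⊈ q → ∃ λ v → v Sub.∈ p × v Sub.∉ q
∃∈∖ p q p⊈q with any? (λ v → (v ∈? p) ×-dec ¬? (v ∈? q))
... | yes w = w
... | no ¬w = ⊥-elim (p⊈q p⊆q)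
  where
  p⊆q : p Sub.⊆ q
  p⊆q {v} v∈p with v ∈? q
  ... | yes v∈q = v∈q
  ... | no  v∉q = contradiction (v , v∈p , v∉q) ¬w

∣∣<⇒∃∈∖ : ∀ {n} (p q : Subset n) → ∣ q ∣ < ∣ p ∣ → ∃ λ v → v Sub.∈ p × v Sub.∉ q
∣∣<⇒∃∈∖ p q q<p = ∃∈∖ p q (λ p⊆q → <⇒≱ q<p (p⊆q⇒∣p∣≤∣q∣ p⊆q))

elements : ∀ {n} → Subset n → List (Fin n)
elements {n} p = filter (_∈? p) (allFin n)

length-elements : ∀ {n} (p : Subset n) → length (elements p) ≡ ∣ p ∣
length-elements {n} p = trans (length-filter (_∈? p) (allFin n)) (sym (∣∣≡∑ p))

∈-elements⁺ : ∀ {n} {p : Subset n} {v} → v Sub.∈ p → v ∈ elements p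
∈-elements⁺ {p = p} {v} = ∈-filter⁺ (_∈? p) (∈-allFin v)

∈-elements⁻ : ∀ {n} {p : Subset n} {v} → v ∈ elements p → v Sub.∈ p
∈-elements⁻ {n} {p} v∈ = proj₂ (∈-filter⁻ (_∈? p) {xs = allFin n} v∈)

elements-unique : ∀ {n} (p : Subset n) → Unique (elements p)
elements-unique {n} p = Unique-filter⁺ (_∈? p) (allFin⁺ n)

module _ {n} {P : Fin n → Set} (P? : Decidable P) where

  comprehension : Subset n
  comprehension = Vec.tabulate (λ v → does (P? v))

  ∈-comprehension⁺ : ∀ {v} → P v → v Sub.∈ comprehension
  ∈-comprehension⁺ {v} pv = lookup⇒[]= v comprehension (trans (lookup∘tabulate _ v) (dec-true (P? v) pv))

  ∈-comprehension⁻ : ∀ {v} → v Sub.∈ comprehension → P v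
  ∈-comprehension⁻ {v} v∈ with P? v | trans (sym (lookup∘tabulate (λ u → does (P? u)) v)) ([]=⇒lookup v∈)
  ... | yes pv | _ = pv
  ... | no _   | ()

-- Relabelling codes by permutations

-- A record, so that the code can be inferred from the proof.
record Partition (c : ℕ) {n} (A : Code n) : Set where
  constructor partition
  field isUniformPartition : IsUniformPartition c n A

open Partition public

module _ {n} (π : Permutation′ n) where

  -- Direct image under `π`, written as a preimage under the inverse so that membership needs no
  -- search.
  image : Subset n → Subset n
  image p = comprehension (λ v → (π ⟨$⟩ˡ v) ∈? p)

  ∈-image⁺ : ∀ {p v} → (π ⟨$⟩ˡ v) Sub.∈ p → v Sub.∈ image p
  ∈-image⁺ {p} = ∈-comprehension⁺ (λ v → (π ⟨$⟩ˡ v) ∈? p)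

  ∈-image⁻ : ∀ {p v} → v Sub.∈ image p → (π ⟨$⟩ˡ v) Sub.∈ p
  ∈-image⁻ {p} = ∈-comprehension⁻ (λ v → (π ⟨$⟩ˡ v) ∈? p)

  ⟨$⟩ˡ-injective : ∀ {u v} → π ⟨$⟩ˡ u ≡ π ⟨$⟩ˡ v → u ≡ v
  ⟨$⟩ˡ-injective eq = trans (sym (inverseʳ π)) (trans (cong (π ⟨$⟩ʳ_) eq) (inverseʳ π))

  ∣image∣ : ∀ p → ∣ image p ∣ ≡ ∣ p ∣
  ∣image∣ p = ≤-antisym
    (∣∣-injection (image p) p (π ⟨$⟩ˡ_) ⟨$⟩ˡ-injective ∈-image⁻)
    (∣∣-injection p (image p) (π ⟨$⟩ʳ_)
      (λ eq → trans (sym (inverseˡ π)) (trans (cong (π ⟨$⟩ˡ_) eq) (inverseˡ π)))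
      (λ v∈p → ∈-image⁺ (subst (Sub._∈ p) (sym (inverseˡ π)) v∈p)))

  image-injective : ∀ {p q} → image p ≡ image q → p ≡ q
  image-injective {p} {q} eq = ⊆-antisym (half eq) (half (sym eq))
    where
    half : ∀ {p q} → image p ≡ image q → p Sub.⊆ q
    half {p} {q} eq v∈p = subst (Sub._∈ q) (inverseˡ π)
      (∈-image⁻ (subst (_ Sub.∈_) eq (∈-image⁺ (subst (Sub._∈ p) (sym (inverseˡ π)) v∈p))))

  image-fixed : ∀ {p} → (∀ {v} → v Sub.∈ p → π ⟨$⟩ˡ v ≡ v) → image p ≡ p
  image-fixed {p} fix = ⊆-antisym
    (λ {v} v∈ → subst (Sub._∈ p) (⟨$⟩ˡ-injective (fix (∈-image⁻ v∈))) (∈-image⁻ v∈))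
    (λ v∈p → ∈-image⁺ (subst (Sub._∈ p) (sym (fix v∈p)) v∈p))

  -- Positions and entries both move, since a code stores each block at all of its points.
  relabel : Code n → Code n
  relabel B = Vec.tabulate (λ v → image (lookup B (π ⟨$⟩ˡ v)))

  lookup-relabel : ∀ B v → lookup (relabel B) v ≡ image (lookup B (π ⟨$⟩ˡ v))
  lookup-relabel B v = lookup∘tabulate _ v

  relabel-injective : ∀ {A B} → relabel A ≡ relabel B → A ≡ B
  relabel-injective {A} {B} eq = trans (sym (tabulate∘lookup A)) (trans (Vec-tabulate-cong pointwise) (tabulate∘lookup B))
    where
    open ≡-Reasoning
    pointwise : ∀ v → lookup A v ≡ lookup B v
    pointwise v = image-injective (begin
      image (lookup A v)                           ≡⟨ cong (image ∘ lookup A) (inverseˡ π) ⟨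
      image (lookup A (π ⟨$⟩ˡ (π ⟨$⟩ʳ v)))         ≡⟨ lookup-relabel A _ ⟨
      lookup (relabel A) (π ⟨$⟩ʳ v)                ≡⟨ cong (λ C → lookup C (π ⟨$⟩ʳ v)) eq ⟩
      lookup (relabel B) (π ⟨$⟩ʳ v)                ≡⟨ lookup-relabel B _ ⟩
      image (lookup B (π ⟨$⟩ˡ (π ⟨$⟩ʳ v)))         ≡⟨ cong (image ∘ lookup B) (inverseˡ π) ⟩
      image (lookup B v)                           ∎)

  relabel-block : ∀ {B p} → IsBlock B p → IsBlock (relabel B) (image p)
  relabel-block {B} {p} (v , eq) = π ⟨$⟩ʳ v ,
    trans (lookup-relabel B _) (trans (cong (image ∘ lookup B) (inverseˡ π)) (cong image eq))

  relabel-partition : ∀ {c B} → Partition c B → Partition c (relabel B)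
  relabel-partition {c} {B} (partition (refl∈ , size , same)) = partition (
    (λ v → subst (v Sub.∈_) (sym (lookup-relabel B v)) (∈-image⁺ (refl∈ _))) ,
    (λ v → trans (cong ∣_∣ (lookup-relabel B v)) (trans (∣image∣ _) (size _))) ,
    (λ u v v∈ → trans (lookup-relabel B v) (trans
      (cong image (same _ _ (∈-image⁻ (subst (v Sub.∈_) (lookup-relabel B u) v∈))))
      (sym (lookup-relabel B u)))))

-- Decidability and the list of all partitions

_≟ˢ_ : ∀ {n} (p q : Subset n) → Dec (p ≡ q)
_≟ˢ_ = ≡-dec Bool._≟_

_≟ᶜ_ : ∀ {n} (A B : Code n) → Dec (A ≡ B)
_≟ᶜ_ = ≡-dec _≟ˢ_

agree? : ∀ {n} (A B : Code n) v → Dec (lookup A v ≡ lookup B v)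
agree? A B v = lookup A v ≟ˢ lookup B v

agreement : ∀ {n} → Code n → Code n → Subset n
agreement A B = comprehension (agree? A B)

isUniformPartition? : ∀ c n → Decidable (IsUniformPartition c n)
isUniformPartition? c n B =
  all? (λ v → v ∈? lookup B v) ×-dec
  all? (λ v → ∣ lookup B v ∣ ≟ c) ×-dec
  all? (λ u → all? (λ v → (v ∈? lookup B u) →-dec (lookup B v ≟ˢ lookup B u)))

isBlock? : ∀ {n} (B : Code n) p → Dec (IsBlock B p)
isBlock? B p = any? (λ v → lookup B v ≟ˢ p)

vectors : List X → ∀ n → List (Vec X n)
vectors xs zero    = [] ∷ []
vectors xs (suc n) = cartesianProductWith _∷_ xs (vectors xs n)

vectors-unique : ∀ {xs : List X} → Unique xs → ∀ n → Unique (vectors xs n)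
vectors-unique xs! zero    = [] ∷ []
vectors-unique xs! (suc n) = cartesianProductWith⁺ _∷_ (λ { refl → refl , refl }) xs! (vectors-unique xs! n)

∈-vectors : ∀ {xs : List X} → (∀ x → x ∈ xs) → ∀ {n} (v : Vec X n) → v ∈ vectors xs n
∈-vectors all []      = here refl
∈-vectors all (x ∷ v) = ∈-cartesianProductWith⁺ _∷_ (all x) (∈-vectors all v)

subsets : ∀ n → List (Subset n)
subsets = vectors (true ∷ false ∷ [])

subsets-unique : ∀ n → Unique (subsets n)
subsets-unique = vectors-unique (((λ ()) ∷ []) ∷ [] ∷ [])

∈-subsets : ∀ {n} (p : Subset n) → p ∈ subsets n
∈-subsets = ∈-vectors (λ { true → here refl ; false → there (here refl) })

-- A finite universe without repetitions: the counts of partitions below are sums of indicators over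
-- this list.
partitions : ∀ c n → List (Code n)
partitions c n = filter (isUniformPartition? c n) (vectors (subsets n) n)

partitions-unique : ∀ c n → Unique (partitions c n)
partitions-unique c n = Unique-filter⁺ (isUniformPartition? c n) (vectors-unique (subsets-unique n) n)

∈-partitions⁺ : ∀ {c n} {B : Code n} → Partition c B → B ∈ partitions c n
∈-partitions⁺ {c} {n} {B} (partition B-part) = ∈-filter⁺ (isUniformPartition? c n) (∈-vectors ∈-subsets B) B-part

∈-partitions⁻ : ∀ {c n} {B : Code n} → B ∈ partitions c n → Partition c B
∈-partitions⁻ {c} {n} B∈ = partition (proj₂ (∈-filter⁻ (isUniformPartition? c n) {xs = vectors (subsets n) n} B∈))

-- Unions of blocks and agreement sets

-- For a partition `A` these are the unions of blocks of `A`; consisting of `r` blocks is recorded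
-- as having size `c * r`.
Closed : ∀ {n} → Code n → Subset n → Set
Closed A W = ∀ {u v} → u Sub.∈ W → v Sub.∈ lookup A u → v Sub.∈ W

module _ {c n} {A : Code n} (A-part : Partition c A) where

  ∈-own-block : ∀ v → v Sub.∈ lookup A v
  ∈-own-block = proj₁ (isUniformPartition A-part)

  ∣block∣ : ∀ v → ∣ lookup A v ∣ ≡ c
  ∣block∣ = proj₁ (proj₂ (isUniformPartition A-part))

  ∈-block⇒≡ : ∀ {u v} → v Sub.∈ lookup A u → lookup A v ≡ lookup A u
  ∈-block⇒≡ {u} {v} = proj₂ (proj₂ (isUniformPartition A-part)) u v

  ∈-isBlock⇒≡ : ∀ {p v} → IsBlock A p → v Sub.∈ p → lookup A v ≡ p
  ∈-isBlock⇒≡ (u , refl) v∈p = ∈-block⇒≡ v∈p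

  ∈-block-sym : ∀ {u v} → v Sub.∈ lookup A u → u Sub.∈ lookup A v
  ∈-block-sym {u} v∈ = subst (u Sub.∈_) (sym (∈-block⇒≡ v∈)) (∈-own-block u)

  block-disjoint : ∀ {W v} → Closed A W → v Sub.∉ W → Disjoint (lookup A v) W
  block-disjoint closed v∉W u∈ u∈W = v∉W (closed u∈W (∈-block-sym u∈))

  block-closed : ∀ v → Closed A (lookup A v)
  block-closed v u∈ w∈ = subst (_ Sub.∈_) (∈-block⇒≡ u∈) w∈

  ∪-closed : ∀ {V W} → Closed A V → Closed A W → Closed A (V Sub.∪ W)
  ∪-closed {V} {W} V-closed W-closed u∈ v∈ with x∈p∪q⁻ V W u∈
  ... | inj₁ u∈V = p⊆p∪q W (V-closed u∈V v∈)
  ... | inj₂ u∈W = q⊆p∪q V W (W-closed u∈W v∈)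

  -- The points `f j` represent distinct blocks. Each new block is disjoint from the union of the
  -- others, so the sizes add up.
  union-of-blocks : ∀ {r} (f : Fin r → Fin n) → Injective _≡_ _≡_ (lookup A ∘ f) →
    ∃ λ W → ∣ W ∣ ≡ c * r ×
      (∀ {v} → v Sub.∈ W → ∃ λ j → v Sub.∈ lookup A (f j)) ×
      (∀ j → lookup A (f j) Sub.⊆ W)
  union-of-blocks {zero}  f f-inj = Sub.⊥ , trans (∣⊥∣≡0 n) (sym (*-zeroʳ c)) , (⊥-elim ∘ ∉⊥) , λ ()
  union-of-blocks {suc r} f f-inj with union-of-blocks (f ∘ suc) (suc-injective ∘ f-inj)
  ... | W , size , W⇒ , ⇒W = b Sub.∪ W , size′ , to , from
    where
    b = lookup A (f zero)
    b#W : Disjoint b W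
    b#W v∈b v∈W with W⇒ v∈W
    ... | j , v∈ with f-inj (trans (sym (∈-block⇒≡ v∈b)) (∈-block⇒≡ v∈))
    ...   | ()
    size′ : ∣ b Sub.∪ W ∣ ≡ c * suc r
    size′ = trans (∣∪∣-disjoint b W b#W) (trans (cong₂ _+_ (∣block∣ _) size) (sym (*-suc c r)))
    to : ∀ {v} → v Sub.∈ b Sub.∪ W → ∃ λ j → v Sub.∈ lookup A (f j)
    to v∈ with x∈p∪q⁻ b W v∈
    ... | inj₁ v∈b = zero , v∈b
    ... | inj₂ v∈W with W⇒ v∈W
    ...   | j , v∈j = suc j , v∈j
    from : ∀ j → lookup A (f j) Sub.⊆ b Sub.∪ W
    from zero    = p⊆p∪q W
    from (suc j) = q⊆p∪q b W ∘ ⇒W j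

  -- Greedy choice: the blocks of `r` chosen points cover only `c * r < ∣ S ∣` points, so `S` has a
  -- point in a new block.
  choose-blocks : 1 ≤ c → ∀ {S} r → c * r ≤ ∣ S ∣ →
    ∃ λ (f : Fin r → Fin n) → Injective _≡_ _≡_ (lookup A ∘ f) × (∀ j → f j Sub.∈ S)
  choose-blocks 1≤c zero    _   = (λ ()) , (λ { {()} }) , λ ()
  choose-blocks 1≤c {S} (suc r) big
    with choose-blocks 1≤c {S} r (≤-trans (*-monoʳ-≤ c (n≤1+n r)) big)
  ... | f , f-inj , f∈S with union-of-blocks f f-inj
  ...   | W , size , W⇒ , ⇒W with ∣∣<⇒∃∈∖ S W smaller
    where
    smaller : ∣ W ∣ < ∣ S ∣
    smaller = begin
      suc ∣ W ∣   ≡⟨ cong suc size ⟩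
      1 + c * r   ≤⟨ +-monoˡ-≤ (c * r) 1≤c ⟩
      c + c * r   ≡⟨ *-suc c r ⟨
      c * suc r   ≤⟨ big ⟩
      ∣ S ∣       ∎
      where open ≤-Reasoning
  ...     | v , v∈S , v∉W = g , g-inj , g∈S
    where
    g : Fin (suc r) → Fin n
    g zero    = v
    g (suc j) = f j
    new : ∀ j → lookup A v ≢ lookup A (f j)
    new j eq = v∉W (⇒W j (subst (v Sub.∈_) eq (∈-own-block v)))
    g-inj : Injective _≡_ _≡_ (lookup A ∘ g)
    g-inj {zero}  {zero}  _  = refl
    g-inj {zero}  {suc j} eq = contradiction eq (new j)
    g-inj {suc i} {zero}  eq = contradiction (sym eq) (new i)
    g-inj {suc i} {suc j} eq = cong suc (f-inj eq)
    g∈S : ∀ j → g j Sub.∈ S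
    g∈S zero    = v∈S
    g∈S (suc j) = f∈S j

  closed-subset : 1 ≤ c → ∀ {S} r → Closed A S → c * r ≤ ∣ S ∣ →
    ∃ λ W → Closed A W × ∣ W ∣ ≡ c * r × W Sub.⊆ S
  closed-subset 1≤c {S} r S-closed big with choose-blocks 1≤c {S} r big
  ... | f , f-inj , f∈S with union-of-blocks f f-inj
  ...   | W , size , W⇒ , ⇒W =
    W , (λ u∈W v∈ → ⇒W _ (block-closed _ (proj₂ (W⇒ u∈W)) v∈)) , size ,
    (λ v∈W → S-closed (f∈S _) (proj₂ (W⇒ v∈W)))

module _ {n} (A B : Code n) where

  ∈-agreement⁺ : ∀ {v} → lookup A v ≡ lookup B v → v Sub.∈ agreement A B
  ∈-agreement⁺ = ∈-comprehension⁺ (agree? A B)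

  ∈-agreement⁻ : ∀ {v} → v Sub.∈ agreement A B → lookup A v ≡ lookup B v
  ∈-agreement⁻ = ∈-comprehension⁻ (agree? A B)

module _ {c n} {A B : Code n} (A-part : Partition c A) (B-part : Partition c B) where

  -- The common block at an agreement point `u` is, in both partitions, the block of each of its
  -- points `v`.
  agreement-closed : Closed A (agreement A B)
  agreement-closed {u} {v} u∈ v∈ = ∈-agreement⁺ A B (trans (∈-block⇒≡ A-part v∈) (trans Au≡Bu
    (sym (∈-block⇒≡ B-part (subst (v Sub.∈_) Au≡Bu v∈)))))
    where Au≡Bu = ∈-agreement⁻ A B u∈

  -- Distinct common blocks are disjoint and consist of `c` agreement points each. Together with
  -- `∣agreement∣⇒common` this turns intersection sizes into point counts.
  common⇒∣agreement∣ : ∀ {t} → CommonAtLeast t A B → c * t ≤ ∣ agreement A B ∣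
  common⇒∣agreement∣ (f , f-inj , blocks) with union-of-blocks A-part (proj₁ ∘ proj₁ ∘ blocks) inj
    where
    inj : Injective _≡_ _≡_ (λ j → lookup A (proj₁ (proj₁ (blocks j))))
    inj {i} {j} eq = f-inj (trans (sym (proj₂ (proj₁ (blocks i)))) (trans eq (proj₂ (proj₁ (blocks j)))))
  ... | W , size , W⇒ , _ = subst (_≤ ∣ agreement A B ∣) size (p⊆q⇒∣p∣≤∣q∣ W⊆)
    where
    W⊆ : W Sub.⊆ agreement A B
    W⊆ {v} v∈W with W⇒ v∈W
    ... | j , v∈ with subst (v Sub.∈_) (proj₂ (proj₁ (blocks j))) v∈
    ...   | v∈fj = ∈-agreement⁺ A B (trans (∈-isBlock⇒≡ A-part (proj₁ (blocks j)) v∈fj)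
                                  (sym (∈-isBlock⇒≡ B-part (proj₂ (blocks j)) v∈fj)))

  ∣agreement∣⇒common : 1 ≤ c → ∀ {t} → c * t ≤ ∣ agreement A B ∣ → CommonAtLeast t A B
  ∣agreement∣⇒common 1≤c {t} big with choose-blocks A-part 1≤c {agreement A B} t big
  ... | f , f-inj , f∈ = lookup A ∘ f , f-inj , λ j → (f j , refl) , (f j , sym (∈-agreement⁻ A B (f∈ j)))

CommonAtLeast-sym : ∀ {n t} {A B : Code n} → CommonAtLeast t A B → CommonAtLeast t B A
CommonAtLeast-sym (f , f-inj , blocks) = f , f-inj , λ j → proj₂ (blocks j) , proj₁ (blocks j)

-- Transpositions of two points

module _ {n} {i j : Fin n} where

  transpose-i : transpose i j ⟨$⟩ˡ i ≡ j
  -- The inverse tests for `j` before `i`, so `i ≡ j` has to be settled first.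
  transpose-i with i Fin.≟ j
  ... | yes i≡j = i≡j
  ... | no _ with i Fin.≟ i
  ...   | yes _  = refl
  ...   | no i≢i = contradiction refl i≢i

  transpose-j : transpose i j ⟨$⟩ˡ j ≡ i
  transpose-j with j Fin.≟ j
  ... | yes _  = refl
  ... | no j≢j = contradiction refl j≢j

  transpose-other : ∀ {v} → v ≢ i → v ≢ j → transpose i j ⟨$⟩ˡ v ≡ v
  transpose-other {v} v≢i v≢j with v Fin.≟ j
  ... | yes v≡j = contradiction v≡j v≢j
  ... | no _ with v Fin.≟ i
  ...   | yes v≡i = contradiction v≡i v≢i
  ...   | no _    = refl

-- Counting the partitions that agree with A on W

Extends : ∀ {n} → Code n → Subset n → Code n → Set
Extends A W B = ∀ v → v Sub.∈ W → lookup A v ≡ lookup B v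

extends? : ∀ {n} (A : Code n) W → Decidable (Extends A W)
extends? A W B = all? (λ v → (v ∈? W) →-dec agree? A B v)

module _ (c : ℕ) {n} (A : Code n) (W : Subset n) where

  -- The number p(W) of the outline.
  extensions : ℕ
  extensions = ∑ (partitions c n) (λ B → 𝟙 (extends? A W B))

  extensionsWith : Subset n → ℕ
  extensionsWith x = ∑ (partitions c n) (λ B → 𝟙 (extends? A W B ×-dec isBlock? B x))

module _ {c n} {A : Code n} (A-part : Partition c A)
         {W : Subset n} (W-closed : Closed A W) where

  -- A permutation that fixes `W` pointwise fixes every block inside the closed set `W`.
  relabel-extends : ∀ π {B} → (∀ {v} → v Sub.∈ W → π ⟨$⟩ˡ v ≡ v) →
    Extends A W B → Extends A W (relabel π B)
  relabel-extends π {B} fix ext v v∈W = begin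
    lookup A v                        ≡⟨ image-fixed π (fix ∘ W-closed v∈W) ⟨
    image π (lookup A v)              ≡⟨ cong (image π) (ext v v∈W) ⟩
    image π (lookup B v)              ≡⟨ cong (image π ∘ lookup B) (fix v∈W) ⟨
    image π (lookup B (π ⟨$⟩ˡ v))     ≡⟨ lookup-relabel π B v ⟨
    lookup (relabel π B) v            ∎
    where open ≡-Reasoning

  extensionsWith-image : ∀ π x → (∀ {v} → v Sub.∈ W → π ⟨$⟩ˡ v ≡ v) →
    extensionsWith c A W x ≤ extensionsWith c A W (image π x)
  extensionsWith-image π x fix = count-injection
    (λ B → extends? A W B ×-dec isBlock? B x) (λ B → extends? A W B ×-dec isBlock? B (image π x))
    (partitions-unique c n) (relabel π) (relabel-injective π)
    (λ {B} B∈ (ext , blk) → ∈-partitions⁺ (relabel-partition π (∈-partitions⁻ B∈)) ,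
      relabel-extends π {B} fix ext , relabel-block π {B} blk)

  extensionsWith-transpose : ∀ {i j} x → i Sub.∉ W → j Sub.∉ W →
    extensionsWith c A W x ≤ extensionsWith c A W (image (transpose i j) x)
  extensionsWith-transpose {i} {j} x i∉W j∉W = extensionsWith-image (transpose i j) x
    (λ v∈W → transpose-other (λ { refl → i∉W v∈W }) (λ { refl → j∉W v∈W }))

  -- Transposing a point of `x` outside `y` with a point of `y` outside `x` does not decrease the
  -- count and brings `x` closer to `y`. By symmetry the count is the same for all sets of one size
  -- that are disjoint from `W`.
  extensionsWith-≤ : ∀ {x y} → ∣ x ∣ ≡ ∣ y ∣ → Disjoint x W → Disjoint y W →
    extensionsWith c A W x ≤ extensionsWith c A W y
  extensionsWith-≤ {x₀} {y} sizes₀ x₀#W y#W = go _ x₀ ≤-refl sizes₀ x₀#W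
    where
    -- `N` bounds the number of points of `x` outside `y`, which each transposition lowers.
    go : ∀ N x → ∣ x Sub.∩ Sub.∁ y ∣ ≤ N → ∣ x ∣ ≡ ∣ y ∣ → Disjoint x W →
      extensionsWith c A W x ≤ extensionsWith c A W y
    go N x bound sizes x#W with x ⊆? y
    ... | yes x⊆y = ≤-reflexive (cong (extensionsWith c A W) (⊆∧∣∣≤⇒≡ x⊆y (≤-reflexive (sym sizes))))
    ... | no  x⊈y with ∃∈∖ x y x⊈y
    ...   | i , i∈x , i∉y with ∃∈∖ y x y⊈x
      where
      y⊈x : y Sub.⊈ x
      y⊈x y⊆x = i∉y (subst (i Sub.∈_) (sym (⊆∧∣∣≤⇒≡ y⊆x (≤-reflexive sizes))) i∈x)
    ...     | j , j∈y , j∉x = descend N bound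
      where
      x′ = image (transpose i j) x
      smaller : x′ Sub.∩ Sub.∁ y Sub.⊂ x Sub.∩ Sub.∁ y
      smaller = sub , i , x∈p∩q⁺ (i∈x , x∉p⇒x∈∁p i∉y) , i∉
        where
        i∉x′ : i Sub.∉ x′
        i∉x′ i∈ = j∉x (subst (Sub._∈ x) (transpose-i {i = i} {j}) (∈-image⁻ (transpose i j) i∈))
        i∉ : i Sub.∉ x′ Sub.∩ Sub.∁ y
        i∉ i∈ = i∉x′ (p∩q⊆p x′ (Sub.∁ y) i∈)
        sub : x′ Sub.∩ Sub.∁ y Sub.⊆ x Sub.∩ Sub.∁ y
        sub {v} v∈ = x∈p∩q⁺ (subst (Sub._∈ x) (transpose-other v≢i v≢j) (∈-image⁻ (transpose i j) v∈x′) , x∉p⇒x∈∁p v∉y)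
          where
          v∈x′ = p∩q⊆p x′ (Sub.∁ y) v∈
          v∉y : v Sub.∉ y
          v∉y = x∈∁p⇒x∉p (p∩q⊆q x′ (Sub.∁ y) v∈)
          v≢i : v ≢ i
          v≢i refl = i∉x′ v∈x′
          v≢j : v ≢ j
          v≢j refl = v∉y j∈y
      x′#W : Disjoint x′ W
      x′#W {v} v∈x′ v∈W = x#W (subst (Sub._∈ x) (transpose-other v≢i v≢j) (∈-image⁻ (transpose i j) v∈x′)) v∈W
        where
        v≢i : v ≢ i
        v≢i refl = x#W i∈x v∈W
        v≢j : v ≢ j
        v≢j refl = y#W j∈y v∈W
      descend : ∀ N → ∣ x Sub.∩ Sub.∁ y ∣ ≤ N → extensionsWith c A W x ≤ extensionsWith c A W y
      descend zero    bound = contradiction (≤-trans (p⊂q⇒∣p∣<∣q∣ smaller) bound) (λ ())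
      descend (suc N) bound = ≤-trans
        (extensionsWith-transpose x (x#W i∈x) (y#W j∈y))
        (go N x′ (s≤s⁻¹ (≤-trans (p⊂q⇒∣p∣<∣q∣ smaller) bound)) (trans (∣image∣ (transpose i j) x) sizes) x′#W)

-- Switching one point of a set

third-element : ∀ {n} (p : Subset n) i j → 3 ≤ ∣ p ∣ → ∃ λ v → v Sub.∈ p × v ≢ i × v ≢ j
third-element p i j 3≤ with ∣∣<⇒∃∈∖ p (Sub.⁅ i ⁆ Sub.∪ Sub.⁅ j ⁆) (≤-trans (s≤s ∣ij∣≤2) 3≤)
  where
  ∣ij∣≤2 : ∣ Sub.⁅ i ⁆ Sub.∪ Sub.⁅ j ⁆ ∣ ≤ 2
  ∣ij∣≤2 = ≤-trans (∣∪∣≤ Sub.⁅ i ⁆ Sub.⁅ j ⁆) (≤-reflexive (cong₂ _+_ (∣⁅x⁆∣≡1 i) (∣⁅x⁆∣≡1 j)))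
... | v , v∈p , v∉ = v , v∈p ,
  (λ { refl → v∉ (p⊆p∪q Sub.⁅ j ⁆ (x∈⁅x⁆ i)) }) ,
  (λ { refl → v∉ (q⊆p∪q Sub.⁅ i ⁆ Sub.⁅ j ⁆ (x∈⁅x⁆ j)) })

module _ {n} {x : Subset n} where

  ∈-swap : ∀ {i j v} → v Sub.∈ x → v ≢ i → v ≢ j → v Sub.∈ image (transpose i j) x
  ∈-swap v∈x v≢i v≢j = ∈-image⁺ (transpose _ _) (subst (Sub._∈ x) (sym (transpose-other v≢i v≢j)) v∈x)

  -- The swapped set lacks exactly one point of `x`, namely `i`, and has exactly one point outside
  -- `x`, namely `j`; hence it determines both.
  swap-injective : ∀ {i j i′ j′} → i Sub.∈ x → j Sub.∉ x → i′ Sub.∈ x → j′ Sub.∉ x →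
    image (transpose i j) x ≡ image (transpose i′ j′) x → i ≡ i′ × j ≡ j′
  swap-injective {i} {j} {i′} {j′} i∈x j∉x i′∈x j′∉x eq = i≡i′ , j≡j′
    where
    i≡i′ : i ≡ i′
    i≡i′ with i Fin.≟ i′
    ... | yes e = e
    ... | no i≢i′ = contradiction
      (subst (Sub._∈ x) (transpose-i {i = i} {j}) (∈-image⁻ (transpose i j)
        (subst (i Sub.∈_) (sym eq) (∈-swap i∈x i≢i′ (λ { refl → j′∉x i∈x }))))) j∉x
    j∈ : j Sub.∈ image (transpose i j) x
    j∈ = ∈-image⁺ (transpose i j) (subst (Sub._∈ x) (sym (transpose-j {i = i} {j})) i∈x)
    j≡j′ : j ≡ j′
    j≡j′ with j Fin.≟ j′
    ... | yes e = e
    ... | no j≢j′ = contradiction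
      (subst (Sub._∈ x) (transpose-other (λ { refl → j∉x i′∈x }) j≢j′)
        (∈-image⁻ (transpose i′ j′) (subst (j Sub.∈_) eq j∈))) j∉x

-- `D` is kept free for two uses: `D = A` detects agreement with `A` beyond `W`, and a `D` that
-- differs from `A` on `W` detects the agreement forced by cross-intersection.
AgreesOutside : ∀ {n} → Code n → Subset n → Code n → Code n → Set
AgreesOutside A W D B = Extends A W B × ∃ λ v → v Sub.∉ W × lookup D v ≡ lookup B v

agreesOutside? : ∀ {n} (A : Code n) W D → Decidable (AgreesOutside A W D)
agreesOutside? A W D B = extends? A W B ×-dec any? (λ v → ¬? (v ∈? W) ×-dec agree? D B v)

module _ {c n} {A : Code n} (A-part : Partition c A) (3≤c : 3 ≤ c)
         {t m} (n≡ : n ≡ c * (t + (2 + m)))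
         {W : Subset n} (W-closed : Closed A W) (∣W∣≡ : ∣ W ∣ ≡ c * t) where

  -- Double counting over the pairs of a point `i` of `x` and a point `j` outside `x` and `W`. What
  -- the outline calls m is `2 + m` here, so there are `c` choices for `i` and `c * (1 + m)` for
  -- `j`.
  extensionsWith-switch : ∀ {x} → ∣ x ∣ ≡ c → Disjoint x W →
    c * (c * (1 + m)) * extensionsWith c A W x ≤ extensions c A W
  extensionsWith-switch {x} ∣x∣≡ x#W = begin
    c * (c * (1 + m)) * extensionsWith c A W x                       ≡⟨ cong (_* extensionsWith c A W x) length-pairs ⟨
    length pairs * extensionsWith c A W x                            ≡⟨ ∑-const pairs _ ⟨
    ∑ pairs (λ _ → extensionsWith c A W x)                           ≤⟨ ∑-mono pairs (λ ij∈ → extensionsWith-transpose A-part W-closed x (x#W (proj₁ (pair ij∈))) (proj₂ (proj₂ (pair ij∈)))) ⟩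
    ∑ pairs (λ ij → extensionsWith c A W (swapped ij))               ≡⟨ ∑-swap pairs (partitions c n) _ ⟩
    ∑ (partitions c n) (λ B → ∑ pairs (λ ij → 𝟙 (event? B ij)))      ≤⟨ ∑-mono (partitions c n) (λ {B} B∈ → ∑-exclusive (event? B) (extends? A W B) pairs-unique (exclusive (∈-partitions⁻ B∈)) (λ _ → proj₁)) ⟩
    extensions c A W                                                 ∎
    where
    open ≤-Reasoning
    rest : Subset n
    rest = Sub.∁ (x Sub.∪ W)
    pairs : List (Fin n × Fin n)
    pairs = cartesianProduct (elements x) (elements rest)
    pairs-unique : Unique pairs
    pairs-unique = cartesianProduct⁺ (elements-unique x) (elements-unique rest)
    swapped : Fin n × Fin n → Subset n
    swapped (i , j) = image (transpose i j) x
    Event : Code n → Fin n × Fin n → Set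
    Event B ij = Extends A W B × IsBlock B (swapped ij)
    event? : ∀ B → Decidable (Event B)
    event? B ij = extends? A W B ×-dec isBlock? B (swapped ij)
    pair : ∀ {i j} → (i , j) ∈ pairs → i Sub.∈ x × j Sub.∉ x × j Sub.∉ W
    pair ij∈ with ∈-cartesianProduct⁻ (elements x) (elements rest) ij∈
    ... | i∈ , j∈ = ∈-elements⁻ i∈ ,
      (λ j∈x → x∈∁p⇒x∉p (∈-elements⁻ j∈) (p⊆p∪q W j∈x)) ,
      (λ j∈W → x∈∁p⇒x∉p (∈-elements⁻ j∈) (q⊆p∪q x W j∈W))
    -- Two of the swapped sets share a point of x since ∣ x ∣ ≥ 3, so a partition has at most one of them as a block.
    exclusive : ∀ {B} → Partition c B → ∀ {ij kl} → ij ∈ pairs → kl ∈ pairs →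
      Event B ij → Event B kl → ij ≡ kl
    exclusive B-part {i , j} {k , l} ij∈ kl∈ (_ , blk) (_ , blk′)
      with pair ij∈ | pair kl∈ | third-element x i k (≤-trans 3≤c (≤-reflexive (sym ∣x∣≡)))
    ... | i∈x , j∉x , _ | k∈x , l∉x , _ | v , v∈x , v≢i , v≢k
      with swap-injective i∈x j∉x k∈x l∉x (trans
        (sym (∈-isBlock⇒≡ B-part blk (∈-swap v∈x v≢i (λ { refl → j∉x v∈x }))))
        (∈-isBlock⇒≡ B-part blk′ (∈-swap v∈x v≢k (λ { refl → l∉x v∈x }))))
    ...   | refl , refl = refl
    n-split : c * (t + (2 + m)) ≡ c * (1 + m) + (c + c * t)
    n-split = identity c t m
      where
      identity : ∀ c t m → c * (t + (2 + m)) ≡ c * (1 + m) + (c + c * t)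
      identity = solve-∀
    ∣rest∣ : ∣ rest ∣ ≡ c * (1 + m)
    ∣rest∣ = begin-equality
      ∣ rest ∣                                   ≡⟨ ∣∁p∣≡n∸∣p∣ (x Sub.∪ W) ⟩
      n ∸ ∣ x Sub.∪ W ∣                          ≡⟨ cong (n ∸_) (∣∪∣-disjoint x W x#W) ⟩
      n ∸ (∣ x ∣ + ∣ W ∣)                        ≡⟨ cong₂ _∸_ (trans n≡ n-split) (cong₂ _+_ ∣x∣≡ ∣W∣≡) ⟩
      c * (1 + m) + (c + c * t) ∸ (c + c * t)    ≡⟨ m+n∸n≡m (c * (1 + m)) (c + c * t) ⟩
      c * (1 + m)                                ∎
    length-pairs : length pairs ≡ c * (c * (1 + m))
    length-pairs = trans (length-cartesianProduct (elements x) (elements rest))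
      (cong₂ _*_ (trans (length-elements x) ∣x∣≡) (trans (length-elements rest) ∣rest∣))

  -- If `x` is disjoint from `W`, this is the switching bound. Otherwise `x` meets `W` and also
  -- leaves it at `v`, while an extension has blocks inside `W` at all points of the closed set `W`;
  -- the count is then zero.
  extensionsWith-small : ∀ {x v} → ∣ x ∣ ≡ c → v Sub.∈ x → v Sub.∉ W →
    4 * (2 + m) * extensionsWith c A W x ≤ extensions c A W
  extensionsWith-small {x} {v} ∣x∣≡ v∈x v∉W with any? (λ u → (u ∈? x) ×-dec (u ∈? W))
  ... | no x#W = ≤-trans (*-monoˡ-≤ (extensionsWith c A W x) coefficient)
                         (extensionsWith-switch ∣x∣≡ (λ u∈x u∈W → x#W (_ , u∈x , u∈W)))
    where
    open ≤-Reasoning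
    -- As `c` is at least 3, the right side is at least 9(1 + m), which exceeds 4(2 + m) by 1 + 5m.
    coefficient : 4 * (2 + m) ≤ c * (c * (1 + m))
    coefficient = begin
      4 * (2 + m)                   ≤⟨ m≤m+n _ (1 + 5 * m) ⟩
      4 * (2 + m) + (1 + 5 * m)     ≡⟨ identity m ⟩
      3 * (3 * (1 + m))             ≤⟨ *-mono-≤ 3≤c (*-monoˡ-≤ (1 + m) 3≤c) ⟩
      c * (c * (1 + m))             ∎
      where
      identity : ∀ m → 4 * (2 + m) + (1 + 5 * m) ≡ 3 * (3 * (1 + m))
      identity = solve-∀
  ... | yes (u , u∈x , u∈W) = begin
    4 * (2 + m) * extensionsWith c A W x        ≤⟨ *-monoʳ-≤ (4 * (2 + m)) (∑-mono (partitions c n) (λ {B} B∈ → impossible B (∈-partitions⁻ B∈))) ⟩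
    4 * (2 + m) * ∑ (partitions c n) (λ _ → 0)  ≡⟨ cong (4 * (2 + m) *_) (∑-zero (partitions c n)) ⟩
    4 * (2 + m) * 0                             ≡⟨ *-zeroʳ (4 * (2 + m)) ⟩
    0                                           ≤⟨ z≤n ⟩
    extensions c A W                            ∎
    where
    open ≤-Reasoning
    impossible : ∀ B → Partition c B → 𝟙 (extends? A W B ×-dec isBlock? B x) ≤ 0
    impossible B B-part with extends? A W B ×-dec isBlock? B x
    ... | no _ = z≤n
    ... | yes (ext , blk) = contradiction
      (W-closed u∈W (subst (v Sub.∈_) (sym (trans (ext u u∈W) (∈-isBlock⇒≡ B-part blk u∈x))) v∈x)) v∉W

  -- A whole block of D, hence at least c points outside W, witnesses AgreesOutside A W D B.
  agreesOutside-small : ∀ {D} → Partition c D →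
    4 * ∑ (partitions c n) (λ B → 𝟙 (agreesOutside? A W D B)) ≤ extensions c A W
  -- `W` need not be a union of blocks of `D`, so the averaging runs over the `c * (2 + m)` points
  -- outside `W`.
  agreesOutside-small {D} D-part = *-cancelˡ-≤ (c * (2 + m)) {{cm≢0}} (begin
    c * (2 + m) * (4 * ∑ L (λ B → 𝟙 (agreesOutside? A W D B)))               ≡⟨ identity c m _ ⟩
    4 * (2 + m) * (c * ∑ L (λ B → 𝟙 (agreesOutside? A W D B)))               ≡⟨ cong (4 * (2 + m) *_) (∑-* L c _) ⟨
    4 * (2 + m) * ∑ L (λ B → c * 𝟙 (agreesOutside? A W D B))                 ≤⟨ *-monoʳ-≤ (4 * (2 + m)) (∑-mono L (λ {B} B∈ → witnesses B (∈-partitions⁻ B∈))) ⟩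
    4 * (2 + m) * ∑ L (λ B → ∑ outer (λ v → 𝟙 (event? B v)))             ≡⟨ cong (4 * (2 + m) *_) (∑-swap L outer _) ⟩
    4 * (2 + m) * ∑ outer (λ v → extensionsWith c A W (lookup D v))      ≡⟨ ∑-* outer (4 * (2 + m)) _ ⟨
    ∑ outer (λ v → 4 * (2 + m) * extensionsWith c A W (lookup D v))      ≤⟨ ∑-mono outer (λ {v} v∈ → extensionsWith-small (∣block∣ D-part v) (∈-own-block D-part v) (x∈∁p⇒x∉p (∈-elements⁻ v∈))) ⟩
    ∑ outer (λ _ → extensions c A W)                                     ≡⟨ ∑-const outer _ ⟩
    length outer * extensions c A W                                      ≡⟨ cong (_* extensions c A W) length-outer ⟩
    c * (2 + m) * extensions c A W                                       ∎)
    where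
    open ≤-Reasoning
    L = partitions c n
    outer : List (Fin n)
    outer = elements (Sub.∁ W)
    event? : ∀ B v → Dec (Extends A W B × IsBlock B (lookup D v))
    event? B v = extends? A W B ×-dec isBlock? B (lookup D v)
    cm≢0 : NonZero (c * (2 + m))
    cm≢0 = >-nonZero (*-mono-≤ (≤-trans (s≤s z≤n) 3≤c) (s≤s (z≤n {1 + m})))
    identity : ∀ c m b → c * (2 + m) * (4 * b) ≡ 4 * (2 + m) * (c * b)
    identity = solve-∀
    length-outer : length outer ≡ c * (2 + m)
    length-outer = begin-equality
      length outer                     ≡⟨ length-elements (Sub.∁ W) ⟩
      ∣ Sub.∁ W ∣                      ≡⟨ ∣∁p∣≡n∸∣p∣ W ⟩
      n ∸ ∣ W ∣                        ≡⟨ cong₂ _∸_ (trans n≡ (*-distribˡ-+ c t (2 + m))) ∣W∣≡ ⟩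
      c * t + c * (2 + m) ∸ c * t      ≡⟨ m+n∸m≡n (c * t) (c * (2 + m)) ⟩
      c * (2 + m)                      ∎
    witnesses : ∀ B → Partition c B → c * 𝟙 (agreesOutside? A W D B) ≤ ∑ outer (λ v → 𝟙 (event? B v))
    witnesses B B-part with agreesOutside? A W D B
    ... | no _ = ≤-trans (≤-reflexive (*-zeroʳ c)) z≤n
    ... | yes (ext , v , v∉W , Dv≡Bv) = begin
      c * 1                                        ≡⟨ *-identityʳ c ⟩
      c                                            ≡⟨ ∣block∣ D-part v ⟨
      ∣ lookup D v ∣                               ≡⟨ ∣∣≡∑ (lookup D v) ⟩
      ∑ (allFin n) (λ u → 𝟙 (u ∈? lookup D v))     ≤⟨ count-injection (_∈? lookup D v) (event? B) (allFin⁺ n) id id (λ _ → in-outer) ⟩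
      ∑ outer (λ u → 𝟙 (event? B u))               ∎
      where
      in-outer : ∀ {u} → u Sub.∈ lookup D v → u ∈ outer × Extends A W B × IsBlock B (lookup D u)
      in-outer {u} u∈ = ∈-elements⁺ (x∉p⇒x∈∁p u∉W) , ext , v , sym (trans (∈-block⇒≡ D-part u∈) Dv≡Bv)
        where
        -- For `u` in `W`, the block of `B` at `u` would be a block of `A` inside `W`, yet it
        -- contains `v`.
        u∉W : u Sub.∉ W
        u∉W u∈W = v∉W (W-closed u∈W (subst (v Sub.∈_) (sym (ext u u∈W))
          (∈-block-sym B-part (subst (u Sub.∈_) Dv≡Bv u∈))))

-- Cross-intersecting families

closed? : ∀ {n} (A : Code n) W → Dec (Closed A W)
closed? A W = map′ (λ h {u} {v} → h u v) (λ h u v → h)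
  (all? (λ u → all? (λ v → (u ∈? W) →-dec ((v ∈? lookup A u) →-dec (v ∈? W)))))

_∈ᶜ?_ : ∀ {n} (B : Code n) 𝓖 → Dec (B ∈ 𝓖)
_∈ᶜ?_ = DecMembership._∈?_ _≟ᶜ_

≢⇒∃lookup≢ : ∀ {n} {A B : Code n} → A ≢ B → ∃ λ v → lookup A v ≢ lookup B v
≢⇒∃lookup≢ {A = A} {B} A≢B with any? (λ v → ¬? (agree? A B v))
... | yes w = w
... | no ¬w = contradiction
  (trans (sym (tabulate∘lookup A)) (trans
    (Vec-tabulate-cong (λ v → decidable-stable (agree? A B v) (λ ≢ → ¬w (v , ≢))))
    (tabulate∘lookup B))) A≢B

length≤∑ : ∀ {c n} {𝓖 : List (Code n)} {P : Code n → Set} (P? : Decidable P) → Unique 𝓖 →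
  (∀ {B} → B ∈ 𝓖 → Partition c B × P B) → length 𝓖 ≤ ∑ (partitions c n) (λ B → 𝟙 (P? B))
length≤∑ {c} {n} P? 𝓖! 𝓖⇒ = ≤-trans
  (Unique-⊆⇒length≤ 𝓖! (λ B∈ → ∈-filter⁺ P? (∈-partitions⁺ (proj₁ (𝓖⇒ B∈))) (proj₂ (𝓖⇒ B∈))))
  (≤-reflexive (length-filter P? (partitions c n)))

module _ {c n} {A : Code n} (A-part : Partition c A) (3≤c : 3 ≤ c)
         {t m} (n≡ : n ≡ c * (t + (2 + m))) where

  private
    L = partitions c n

    1≤c : 1 ≤ c
    1≤c = ≤-trans (s≤s z≤n) 3≤c

  exact? : ∀ W (B : Code n) → Dec (agreement A B ≡ W)
  exact? W B = agreement A B ≟ˢ W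

  large? : (B : Code n) → Dec (c * t ≤ ∣ agreement A B ∣)
  large? B = c * t ≤? ∣ agreement A B ∣

  module _ {W : Subset n} (W-closed : Closed A W) (∣W∣≡ : ∣ W ∣ ≡ c * t) where

    -- An extension whose agreement with `A` is not exactly `W` agrees with `A` outside `W`, which
    -- happens for at most a quarter of them.
    exact-large : 3 * extensions c A W ≤ 4 * ∑ L (λ B → 𝟙 (exact? W B))
    exact-large = +-cancelʳ-≤ (extensions c A W) _ _ (begin
      3 * p + p             ≡⟨ +-comm (3 * p) p ⟩
      4 * p                 ≤⟨ *-monoʳ-≤ 4 (≤-trans (∑-mono L (λ {B} _ → split B)) (≤-reflexive (∑-+ L _ _))) ⟩
      4 * (e + b)           ≡⟨ *-distribˡ-+ 4 e b ⟩
      4 * e + 4 * b         ≤⟨ +-monoʳ-≤ (4 * e) (agreesOutside-small A-part 3≤c n≡ W-closed ∣W∣≡ A-part) ⟩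
      4 * e + p             ∎)
      where
      open ≤-Reasoning
      outside? : Decidable (AgreesOutside A W A)
      outside? = agreesOutside? A W A
      p = extensions c A W
      e = ∑ L (λ B → 𝟙 (exact? W B))
      b = ∑ L (λ B → 𝟙 (outside? B))
      split : ∀ B → 𝟙 (extends? A W B) ≤ 𝟙 (exact? W B) + 𝟙 (outside? B)
      split B = 𝟙-⊎ (extends? A W B) (exact? W B) (outside? B) cases
        where
        cases : Extends A W B → agreement A B ≡ W ⊎ AgreesOutside A W A B
        cases ext with agreement A B ⊆? W
        ... | yes sub = inj₁ (⊆-antisym sub (λ {v} v∈W → ∈-agreement⁺ A B (ext v v∈W)))
        ... | no ¬sub with ∃∈∖ (agreement A B) W ¬sub
        ...   | v , v∈ , v∉W = inj₂ (ext , v , v∉W , ∈-agreement⁻ A B v∈)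

    module _ {𝓖 : List (Code n)} {D : Code n} (D-part : Partition c D)
             (D-cross : ∀ {B} → B ∈ 𝓖 → c * t ≤ ∣ agreement D B ∣)
             {w} (w∈W : w Sub.∈ W) (Aw≢Dw : lookup A w ≢ lookup D w) where

      -- `D` and `B` agree in at least `∣ W ∣` points. If all of these were in `W`, they would fill
      -- `W` and include `w`, where `B` follows `A` but `D` does not. So `D` and `B` agree outside
      -- `W`.
      crossing-small : 4 * ∑ L (λ B → 𝟙 ((B ∈ᶜ? 𝓖) ×-dec extends? A W B)) ≤ extensions c A W
      crossing-small = ≤-trans
        (*-monoʳ-≤ 4 (∑-mono L (λ {B} _ → 𝟙-mono ((B ∈ᶜ? 𝓖) ×-dec extends? A W B) (outside? B) (to B))))
        (agreesOutside-small A-part 3≤c n≡ W-closed ∣W∣≡ D-part)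
        where
        outside? : Decidable (AgreesOutside A W D)
        outside? = agreesOutside? A W D
        to : ∀ B → B ∈ 𝓖 × Extends A W B → AgreesOutside A W D B
        to B (B∈ , ext) with ∃∈∖ (agreement D B) W ¬sub
          where
          ¬sub : agreement D B Sub.⊈ W
          ¬sub sub = Aw≢Dw (trans (ext w w∈W) (sym (∈-agreement⁻ D B (subst (w Sub.∈_)
            (sym (⊆∧∣∣≤⇒≡ sub (≤-trans (≤-reflexive ∣W∣≡) (D-cross B∈)))) w∈W))))
        ... | v , v∈ , v∉W = ext , v , v∉W , ∈-agreement⁻ D B v∈

      -- Twice at most p/4 is below the 3p/4 exact ones.
      twice-crossing≤exact : 2 * ∑ L (λ B → 𝟙 ((B ∈ᶜ? 𝓖) ×-dec extends? A W B)) ≤ ∑ L (λ B → 𝟙 (exact? W B))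
      twice-crossing≤exact = *-cancelˡ-≤ 4 (begin
        4 * (2 * g)     ≡⟨ identity g ⟩
        2 * (4 * g)     ≤⟨ *-monoʳ-≤ 2 crossing-small ⟩
        2 * p           ≤⟨ *-monoˡ-≤ p (n≤1+n 2) ⟩
        3 * p           ≤⟨ exact-large ⟩
        4 * e           ∎)
        where
        open ≤-Reasoning
        g = ∑ L (λ B → 𝟙 ((B ∈ᶜ? 𝓖) ×-dec extends? A W B))
        p = extensions c A W
        e = ∑ L (λ B → 𝟙 (exact? W B))
        identity : ∀ g → 4 * (2 * g) ≡ 2 * (4 * g)
        identity = solve-∀

      -- Of the at least 3p/4 exact ones, `𝓖` contains at most p/4, so at least p/2 are missed.
      extensions≤twice-missed :
        extensions c A W ≤ 2 * ∑ L (λ B → 𝟙 (exact? W B ×-dec ¬? (B ∈ᶜ? 𝓖)))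
      extensions≤twice-missed = *-cancelˡ-≤ 2 (+-cancelʳ-≤ p _ _ (begin
        2 * p + p             ≡⟨ +-comm (2 * p) p ⟩
        3 * p                 ≤⟨ exact-large ⟩
        4 * ∑ L (λ B → 𝟙 (exact? W B))  ≤⟨ *-monoʳ-≤ 4 (≤-trans (∑-mono L (λ {B} _ → split B)) (≤-reflexive (∑-+ L _ _))) ⟩
        4 * (e + g)           ≡⟨ identity e g ⟩
        2 * (2 * e) + 4 * g   ≤⟨ +-monoʳ-≤ (2 * (2 * e)) crossing-small ⟩
        2 * (2 * e) + p       ∎))
        where
        open ≤-Reasoning
        p = extensions c A W
        e = ∑ L (λ B → 𝟙 (exact? W B ×-dec ¬? (B ∈ᶜ? 𝓖)))
        g = ∑ L (λ B → 𝟙 ((B ∈ᶜ? 𝓖) ×-dec extends? A W B))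
        identity : ∀ e g → 4 * (e + g) ≡ 2 * (2 * e) + 4 * g
        identity = solve-∀
        split : ∀ B → 𝟙 (exact? W B) ≤
          𝟙 (exact? W B ×-dec ¬? (B ∈ᶜ? 𝓖)) + 𝟙 ((B ∈ᶜ? 𝓖) ×-dec extends? A W B)
        split B = 𝟙-⊎ (exact? W B) (exact? W B ×-dec ¬? (B ∈ᶜ? 𝓖)) ((B ∈ᶜ? 𝓖) ×-dec extends? A W B) cases
          where
          cases : agreement A B ≡ W → _
          cases eq with B ∈ᶜ? 𝓖
          ... | yes B∈ = inj₂ (B∈ , λ v v∈W → ∈-agreement⁻ A B (subst (v Sub.∈_) (sym eq) v∈W))
          ... | no  B∉ = inj₁ (eq , B∉)

  -- The common part of one family and the bound for the pair

  module _ {𝓕 𝓖 : List (Code n)} (A∈𝓕 : A ∈ 𝓕)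
           (𝓕! : Unique 𝓕) (𝓖! : Unique 𝓖)
           (𝓕-part : ∀ {B} → B ∈ 𝓕 → Partition c B) (𝓖-part : ∀ {B} → B ∈ 𝓖 → Partition c B)
           (cross : ∀ {D B} → D ∈ 𝓕 → B ∈ 𝓖 → c * t ≤ ∣ agreement D B ∣) where

    private
      M = ∑ L (λ B → 𝟙 (large? B))
      everywhere? : ∀ v → Dec (All (λ D → lookup A v ≡ lookup D v) 𝓕)
      everywhere? v = All.all? (λ D → agree? A D v) 𝓕

    -- The set S of the outline.
    core : Subset n
    core = comprehension everywhere?

    ∈-core⁻ : ∀ {v D} → v Sub.∈ core → D ∈ 𝓕 → lookup A v ≡ lookup D v
    ∈-core⁻ v∈ D∈ = All.lookup (∈-comprehension⁻ everywhere? v∈) D∈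

    ∉-core⁻ : ∀ {v} → v Sub.∉ core → ∃ λ D → D ∈ 𝓕 × lookup A v ≢ lookup D v
    ∉-core⁻ {v} v∉ = find (¬All⇒Any¬ (λ D → agree? A D v) 𝓕 (v∉ ∘ ∈-comprehension⁺ everywhere?))

    core-closed : Closed A core
    core-closed u∈ v∈ = ∈-comprehension⁺ everywhere? (All.tabulate (λ {D} D∈ →
      ∈-agreement⁻ A D (agreement-closed A-part (𝓕-part D∈) (∈-agreement⁺ A D (∈-core⁻ u∈ D∈)) v∈)))

    -- Every member of `𝓖` agrees with `A` on some union `W` of `t` blocks. No such `W` fits into
    -- the core, so some member of `𝓕` differs from `A` on it and `twice-crossing≤exact` applies.
    small-core-bound : ∣ core ∣ < c * t → 2 * length 𝓖 ≤ M
    small-core-bound small = begin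
      2 * length 𝓖                                                  ≤⟨ *-monoʳ-≤ 2 (length≤∑ (_∈ᶜ? 𝓖) 𝓖! (λ B∈ → 𝓖-part B∈ , B∈)) ⟩
      2 * ∑ L (λ B → 𝟙 (B ∈ᶜ? 𝓖))                                   ≤⟨ *-monoʳ-≤ 2 (∑-mono L (λ {B} _ → cover B)) ⟩
      2 * ∑ L (λ B → ∑ Ws (λ W → 𝟙 (crossing? W B)))                ≡⟨ cong (2 *_) (∑-swap L Ws _) ⟩
      2 * ∑ Ws (λ W → ∑ L (λ B → 𝟙 (crossing? W B)))                ≡⟨ ∑-* Ws 2 _ ⟨
      ∑ Ws (λ W → 2 * ∑ L (λ B → 𝟙 (crossing? W B)))                ≤⟨ ∑-mono Ws each ⟩
      ∑ Ws (λ W → ∑ L (λ B → 𝟙 (exact? W B)))                       ≡⟨ ∑-swap Ws L _ ⟩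
      -- A partition has only one agreement set with `A`, so it is exact for at most one `W`.
      ∑ L (λ B → ∑ Ws (λ W → 𝟙 (exact? W B)))                       ≤⟨ ∑-mono L (λ {B} _ → ∑-exclusive (λ W → exact? W B) (large? B) (Unique-filter⁺ wanted? (subsets-unique n)) (λ _ _ eq eq′ → trans (sym eq) eq′) (λ W∈ eq → ≤-reflexive (sym (trans (cong ∣_∣ eq) (proj₂ (wanted⁻ W∈)))))) ⟩
      M                                                             ∎
      where
      open ≤-Reasoning
      Wanted : Subset n → Set
      Wanted W = Closed A W × ∣ W ∣ ≡ c * t
      wanted? : Decidable Wanted
      wanted? W = closed? A W ×-dec (∣ W ∣ ≟ c * t)
      Ws : List (Subset n)
      Ws = filter wanted? (subsets n)
      wanted⁻ : ∀ {W} → W ∈ Ws → Wanted W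
      wanted⁻ W∈ = proj₂ (∈-filter⁻ wanted? {xs = subsets n} W∈)
      crossing? : ∀ W B → Dec (B ∈ 𝓖 × Extends A W B)
      crossing? W B = (B ∈ᶜ? 𝓖) ×-dec extends? A W B
      cover : ∀ B → 𝟙 (B ∈ᶜ? 𝓖) ≤ ∑ Ws (λ W → 𝟙 (crossing? W B))
      cover B = 𝟙-≤ (B ∈ᶜ? 𝓖) covered
        where
        covered : B ∈ 𝓖 → 1 ≤ ∑ Ws (λ W → 𝟙 (crossing? W B))
        covered B∈ with closed-subset A-part 1≤c t (agreement-closed A-part (𝓖-part B∈)) (cross A∈𝓕 B∈)
        ... | W , W-closed , ∣W∣≡ , W⊆ = ≤-trans
          (≤-reflexive (sym (𝟙-true (crossing? W B) (B∈ , λ v v∈W → ∈-agreement⁻ A B (W⊆ v∈W)))))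
          (∑-∈ (λ W → 𝟙 (crossing? W B)) (∈-filter⁺ wanted? (∈-subsets W) ((λ {u} {v} → W-closed {u} {v}) , ∣W∣≡)))
      each : ∀ {W} → W ∈ Ws → 2 * ∑ L (λ B → 𝟙 (crossing? W B)) ≤ ∑ L (λ B → 𝟙 (exact? W B))
      each {W} W∈ with wanted⁻ W∈
      ... | W-closed , ∣W∣≡ with ∣∣<⇒∃∈∖ W core (subst (∣ core ∣ <_) (sym ∣W∣≡) small)
      ...   | v , v∈W , v∉ with ∉-core⁻ v∉
      ...     | D , D∈ , Av≢Dv = twice-crossing≤exact W-closed ∣W∣≡ (𝓕-part D∈) (cross D∈) v∈W Av≢Dv

    large-core-bound : ∀ {A′} → 1 ≤ t → A′ ∈ 𝓕 → A ≢ A′ → c * t ≤ ∣ core ∣ →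
      length 𝓕 + length 𝓖 ≤ M
    large-core-bound {A′} 1≤t A′∈ A≢A′ big
      with ≢⇒∃lookup≢ A≢A′ | closed-subset A-part 1≤c (t ∸ 1) core-closed (≤-trans (*-monoʳ-≤ c (m∸n≤m t 1)) big)
    -- `y` lies in the block of `A′` at `x` but not in that of `A`, which gives a second block of
    -- `A` on which `A′` differs. `z` gives the block shared by all of `𝓕` that completes the
    -- `t ∸ 1` blocks of `R`.
    ... | x , Ax≢A′x | R , R-closed , ∣R∣≡ , R⊆core with ∃∈∖ (lookup A′ x) (lookup A x) ⊈ | ∣∣<⇒∃∈∖ core R ∣R∣<
      where
      A′-part = 𝓕-part A′∈
      ⊈ : lookup A′ x Sub.⊈ lookup A x
      ⊈ sub = Ax≢A′x (sym (⊆∧∣∣≤⇒≡ sub (≤-reflexive (trans (∣block∣ A-part x) (sym (∣block∣ A′-part x))))))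
      ∣R∣< : ∣ R ∣ < ∣ core ∣
      ∣R∣< = begin-strict
        ∣ R ∣          ≡⟨ ∣R∣≡ ⟩
        c * (t ∸ 1)    <⟨ *-monoʳ-< c {{>-nonZero 1≤c}} (∸-monoʳ-< (s≤s z≤n) 1≤t) ⟩
        c * t          ≤⟨ big ⟩
        ∣ core ∣       ∎
        where open ≤-Reasoning
    ...   | y , y∈A′x , y∉Ax | z , z∈core , z∉R = begin
      length 𝓕 + length 𝓖                             ≤⟨ +-mono-≤ 𝓕-bound (length≤∑ (_∈ᶜ? 𝓖) 𝓖! (λ B∈ → 𝓖-part B∈ , B∈)) ⟩
      missed x + missed y + ∑ L (λ B → 𝟙 (B ∈ᶜ? 𝓖))   ≤⟨ +-monoˡ-≤ _ both-missed ⟩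
      ∑ L (λ B → 𝟙 (rest? B)) + ∑ L (λ B → 𝟙 (B ∈ᶜ? 𝓖)) ≡⟨ ∑-+ L _ _ ⟨
      ∑ L (λ B → 𝟙 (rest? B) + 𝟙 (B ∈ᶜ? 𝓖))           ≤⟨ ∑-mono L (λ {B} _ → 𝟙-disjoint (rest? B) (B ∈ᶜ? 𝓖) (large? B) proj₁ (cross A∈𝓕) proj₂) ⟩
      M                                               ∎
      where
      open ≤-Reasoning
      A′-part = 𝓕-part A′∈

      -- The block of `A′` at `y` contains `x`; were it also the block of `A`, then `y` would lie in
      -- the block of `A` at `x`.
      Ay≢A′y : lookup A y ≢ lookup A′ y
      Ay≢A′y eq = y∉Ax (∈-block-sym A-part (subst (x Sub.∈_) (sym eq) (∈-block-sym A′-part y∈A′x)))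

      ∉core : ∀ {v} → lookup A v ≢ lookup A′ v → v Sub.∉ core
      ∉core Av≢ v∈ = Av≢ (∈-core⁻ v∈ A′∈)

      W : Fin n → Subset n
      W v = lookup A v Sub.∪ R

      v∈W : ∀ v → v Sub.∈ W v
      v∈W v = p⊆p∪q R (∈-own-block A-part v)

      W-closed : ∀ v → Closed A (W v)
      W-closed v = ∪-closed A-part (block-closed A-part v) R-closed

      Av#R : ∀ {v} → v Sub.∉ R → Disjoint (lookup A v) R
      Av#R = block-disjoint A-part R-closed

      ∣W∣≡ : ∀ {v} → v Sub.∉ R → ∣ W v ∣ ≡ c * t
      ∣W∣≡ {v} v∉R = begin-equality
        ∣ W v ∣                    ≡⟨ ∣∪∣-disjoint (lookup A v) R (Av#R v∉R) ⟩
        ∣ lookup A v ∣ + ∣ R ∣     ≡⟨ cong₂ _+_ (∣block∣ A-part v) ∣R∣≡ ⟩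
        c + c * (t ∸ 1)            ≡⟨ *-suc c (t ∸ 1) ⟨
        c * suc (t ∸ 1)            ≡⟨ cong (c *_) (m+[n∸m]≡n 1≤t) ⟩
        c * t                      ∎

      missed? : ∀ v B → Dec (agreement A B ≡ W v × ¬ B ∈ 𝓖)
      missed? v B = exact? (W v) B ×-dec ¬? (B ∈ᶜ? 𝓖)

      missed : Fin n → ℕ
      missed v = ∑ L (λ B → 𝟙 (missed? v B))

      -- All members of `𝓕` agree with `A` on `R` and have its block at `z`. By `extensionsWith-≤`
      -- that block may be exchanged for the one at `v`, where `A′` differs and `𝓖` misses at least
      -- half of the extensions.
      𝓕≤twice-missed : ∀ {v} → lookup A v ≢ lookup A′ v → length 𝓕 ≤ 2 * missed v
      𝓕≤twice-missed {v} Av≢ = begin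
        length 𝓕                           ≤⟨ length≤∑ (λ B → extends? A R B ×-dec isBlock? B (lookup A z)) 𝓕! (λ B∈ → 𝓕-part B∈ , (λ u u∈R → ∈-core⁻ (R⊆core u∈R) B∈) , z , sym (∈-core⁻ z∈core B∈)) ⟩
        extensionsWith c A R (lookup A z)  ≤⟨ extensionsWith-≤ A-part R-closed (trans (∣block∣ A-part z) (sym (∣block∣ A-part v))) (Av#R z∉R) (Av#R v∉R) ⟩
        extensionsWith c A R (lookup A v)  ≤⟨ ∑-mono L (λ {B} B∈ → 𝟙-mono (extends? A R B ×-dec isBlock? B (lookup A v)) (extends? A (W v) B) (extend B (∈-partitions⁻ B∈))) ⟩
        extensions c A (W v)               ≤⟨ extensions≤twice-missed (W-closed v) (∣W∣≡ v∉R) A′-part (cross A′∈) (v∈W v) Av≢ ⟩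
        2 * missed v                       ∎
        where
        v∉R : v Sub.∉ R
        v∉R = ∉core Av≢ ∘ R⊆core
        extend : ∀ B → Partition c B → Extends A R B × IsBlock B (lookup A v) → Extends A (W v) B
        extend B B-part (ext , blk) u u∈ with x∈p∪q⁻ (lookup A v) R u∈
        ... | inj₁ u∈Av = trans (∈-block⇒≡ A-part u∈Av) (sym (∈-isBlock⇒≡ B-part blk u∈Av))
        ... | inj₂ u∈R  = ext u u∈R

      𝓕-bound : length 𝓕 ≤ missed x + missed y
      𝓕-bound = *-cancelˡ-≤ 2 (begin
        2 * length 𝓕                    ≡⟨ cong (length 𝓕 +_) (+-identityʳ (length 𝓕)) ⟩
        length 𝓕 + length 𝓕             ≤⟨ +-mono-≤ (𝓕≤twice-missed Ax≢A′x) (𝓕≤twice-missed Ay≢A′y) ⟩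
        2 * missed x + 2 * missed y     ≡⟨ *-distribˡ-+ 2 (missed x) (missed y) ⟨
        2 * (missed x + missed y)       ∎)

      -- Keeps the partitions missed at `x` and at `y` apart, so that both halves can be charged to
      -- `M`.
      Wx≢Wy : W x ≢ W y
      Wx≢Wy eq with x∈p∪q⁻ (lookup A y) R (subst (x Sub.∈_) eq (v∈W x))
      ... | inj₁ x∈Ay = y∉Ax (∈-block-sym A-part x∈Ay)
      ... | inj₂ x∈R  = ∉core Ax≢A′x (R⊆core x∈R)

      rest? : ∀ B → Dec (c * t ≤ ∣ agreement A B ∣ × ¬ B ∈ 𝓖)
      rest? B = large? B ×-dec ¬? (B ∈ᶜ? 𝓖)

      missed⇒rest : ∀ {v B} → lookup A v ≢ lookup A′ v →
        agreement A B ≡ W v × ¬ B ∈ 𝓖 → c * t ≤ ∣ agreement A B ∣ × ¬ B ∈ 𝓖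
      missed⇒rest Av≢ (eq , B∉) =
        ≤-reflexive (sym (trans (cong ∣_∣ eq) (∣W∣≡ (∉core Av≢ ∘ R⊆core)))) , B∉

      both-missed : missed x + missed y ≤ ∑ L (λ B → 𝟙 (rest? B))
      both-missed = ≤-trans (≤-reflexive (sym (∑-+ L _ _))) (∑-mono L (λ {B} _ →
        𝟙-disjoint (missed? x B) (missed? y B) (rest? B)
          (missed⇒rest {B = B} Ax≢A′x) (missed⇒rest {B = B} Ay≢A′y)
          (λ (eq , _) (eq′ , _) → Wx≢Wy (trans (sym eq) eq′))))

    -- For a small core only `𝓖` has been bounded; `𝓕` being the smaller family then bounds the sum
    -- by `2 * length 𝓖`.
    cross-bound : ∀ {A′} → 1 ≤ t → A′ ∈ 𝓕 → A ≢ A′ → length 𝓕 ≤ length 𝓖 → length 𝓕 + length 𝓖 ≤ M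
    cross-bound 1≤t A′∈ A≢A′ 𝓕≤𝓖 with c * t ≤? ∣ core ∣
    ... | yes big = large-core-bound 1≤t A′∈ A≢A′ big
    ... | no ¬big = begin
      length 𝓕 + length 𝓖   ≤⟨ +-monoˡ-≤ (length 𝓖) 𝓕≤𝓖 ⟩
      length 𝓖 + length 𝓖   ≡⟨ cong (length 𝓖 +_) (+-identityʳ (length 𝓖)) ⟨
      2 * length 𝓖          ≤⟨ small-core-bound (≰⇒> ¬big) ⟩
      M                     ∎
      where open ≤-Reasoning

-- With `3 ≤ c`, the inequality `t * t ≤ 2 ^ (c ∸ 3)` is the logarithmic condition in exponential
-- form.
theorem1p3 : (c k t : ℕ) → 1 ≤ t → 3 ≤ c → t + 2 ≤ k →
    (𝓕 𝓖 : List (Code (c * k))) →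
    Admissible c k t 𝓕 𝓖 →
    length 𝓕 ≤ length 𝓖 →
    ((𝓕′ 𝓖′ : List (Code (c * k))) → Admissible c k t 𝓕′ 𝓖′ →
    length 𝓕′ + length 𝓖′ ≤ length 𝓕 + length 𝓖) →
    (t * t ≤ 2 ^ (c ∸ 3) ⊎ 2 * t + 2 ≤ k) →
    Σ (Code (c * k)) λ C → IsUniformPartition c (c * k) C ×
    ((X : Code (c * k)) → (X ∈ 𝓕) ⇔ (X ≡ C)) ×
    ((X : Code (c * k)) →
    (X ∈ 𝓖) ⇔ (IsUniformPartition c (c * k) X × CommonAtLeast t X C))
theorem1p3 c k t 1≤t 3≤c t+2≤k (A ∷ 𝓕₁) 𝓖
  ((𝓕! , 𝓕-part) , (𝓖! , 𝓖-part) , _ , 𝓖-nonempty , cross) 𝓕≤𝓖 maximum _ =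
  A , isUniformPartition A-part ,
  (λ X → mk⇔ 𝓕⇒≡A (λ { refl → here refl })) ,
  (λ X → mk⇔
    (λ X∈ → All.lookup 𝓖-part X∈ , CommonAtLeast-sym {A = A} {X} (cross (here refl) X∈))
    (λ (X-part , common) → complete X-part common))
  where
  open ≤-Reasoning

  𝓕 : List (Code (c * k))
  𝓕 = A ∷ 𝓕₁

  𝓕-partition : ∀ {D} → D ∈ 𝓕 → Partition c D
  𝓕-partition D∈ = partition (All.lookup 𝓕-part D∈)

  𝓖-partition : ∀ {B} → B ∈ 𝓖 → Partition c B
  𝓖-partition B∈ = partition (All.lookup 𝓖-part B∈)

  A-part : Partition c A
  A-part = 𝓕-partition (here refl)

  1≤c : 1 ≤ c
  1≤c = ≤-trans (s≤s z≤n) 3≤c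

  -- By `t + 2 ≤ k` the truncated subtraction is exact, so `k ∸ (t + 2)` serves as the `m` of the
  -- counting lemmas.
  n≡ : c * k ≡ c * (t + (2 + (k ∸ (t + 2))))
  n≡ = cong (c *_) (trans (sym (m+[n∸m]≡n t+2≤k)) (+-assoc t 2 _))

  agreement-large : ∀ {D B} → D ∈ 𝓕 → B ∈ 𝓖 → c * t ≤ ∣ agreement D B ∣
  agreement-large D∈ B∈ = common⇒∣agreement∣ (𝓕-partition D∈) (𝓖-partition B∈) (cross D∈ B∈)

  large : Decidable (λ B → c * t ≤ ∣ agreement A B ∣)
  large = large? A-part 3≤c n≡

  -- The largest family that can be paired with the singleton of `A`; its length is the M of the
  -- outline.
  𝓖* : List (Code (c * k))
  𝓖* = filter large (partitions c (c * k))

  ∈𝓖*⁺ : ∀ {B} → Partition c B → CommonAtLeast t A B → B ∈ 𝓖*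
  ∈𝓖*⁺ B-part common = ∈-filter⁺ large (∈-partitions⁺ B-part) (common⇒∣agreement∣ A-part B-part common)

  ∈𝓖*⁻ : ∀ {B} → B ∈ 𝓖* → Partition c B × CommonAtLeast t A B
  ∈𝓖*⁻ B∈ with ∈-filter⁻ large {xs = partitions c (c * k)} B∈
  ... | B∈L , big = ∈-partitions⁻ B∈L , ∣agreement∣⇒common A-part (∈-partitions⁻ B∈L) 1≤c big

  𝓖⊆𝓖* : 𝓖 ⊆ 𝓖*
  𝓖⊆𝓖* B∈ = ∈𝓖*⁺ (𝓖-partition B∈) (cross (here refl) B∈)

  star-admissible : Admissible c k t (A ∷ []) 𝓖*
  star-admissible =
    ([] ∷ [] , isUniformPartition A-part ∷ []) ,
    (Unique-filter⁺ large (partitions-unique c (c * k)) ,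
      All.tabulate (isUniformPartition ∘ proj₁ ∘ ∈𝓖*⁻)) ,
    s≤s z≤n , ≤-trans 𝓖-nonempty (Unique-⊆⇒length≤ 𝓖! 𝓖⊆𝓖*) ,
    (λ { (here refl) B∈ → proj₂ (∈𝓖*⁻ B∈) })

  -- A second member of `𝓕` would bound the sum by `length 𝓖*`, one less than the competing pair
  -- attains.
  𝓕⇒≡A : ∀ {X} → X ∈ 𝓕 → X ≡ A
  𝓕⇒≡A {X} X∈ with A ≟ᶜ X
  ... | yes A≡X = sym A≡X
  ... | no  A≢X = contradiction (maximum (A ∷ []) 𝓖* star-admissible) (<⇒≱ (s≤s (begin
    length 𝓕 + length 𝓖                              ≤⟨ cross-bound A-part 3≤c n≡ (here refl) 𝓕! 𝓖!
                                                          𝓕-partition 𝓖-partition agreement-large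
                                                          1≤t X∈ A≢X 𝓕≤𝓖 ⟩
    ∑ (partitions c (c * k)) (λ B → 𝟙 (large B))     ≡⟨ length-filter large (partitions c (c * k)) ⟨
    length 𝓖*                                        ∎)))

  -- Since `A` is the only member of `𝓕`, a missing `X` could be added to `𝓖` without losing
  -- admissibility, which would raise the maximum by one.
  complete : ∀ {X} → IsUniformPartition c (c * k) X → CommonAtLeast t X A → X ∈ 𝓖
  complete {X} X-part common with X ∈ᶜ? 𝓖
  ... | yes X∈ = X∈
  ... | no  X∉ = contradiction (maximum 𝓕 (X ∷ 𝓖) bigger) (<⇒≱ (+-monoʳ-< (length 𝓕) (n<1+n (length 𝓖))))
    where
    bigger : Admissible c k t 𝓕 (X ∷ 𝓖)
    bigger = (𝓕! , 𝓕-part) ,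
      (All.tabulate (λ { B∈ refl → X∉ B∈ }) ∷ 𝓖! , X-part ∷ 𝓖-part) ,
      s≤s z≤n , s≤s z≤n ,
      (λ { D∈ (here refl) → subst (λ D → CommonAtLeast t D X) (sym (𝓕⇒≡A D∈)) (CommonAtLeast-sym {A = X} {A} common)
         ; D∈ (there B∈)  → cross D∈ B∈ })
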